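{- Let $G_1$ and $G_2$ be edge-disjoint graphs, and let $f=(x,y)$ be a pair of vertices with $x,y\in V(G_1)\cap V(G_2)$ that is a nonedge of both $G_1$ and $G_2$. Then $G_1\cup G_2$ is: (i) nucleation-free, if $G_1$ and $G_2$ are nucleation-free and $V(G_1)\cap V(G_2)=\{x,y\}$; (ii) dependent, if $f$ is an implied nonedge of both $G_1$ and $G_2$; (iii) a circuit, if $V(G_1)\cap V(G_2)=\{x,y\}$ and both $G_1\cup f$ and $G_2\cup f$ are circuits. Moreover, in cases (ii) and (iii), $f$ is an implied nonedge of $G_1\cup G_2$.
   Context: All graphs are finite and simple. Rank, independence, rigidity and circuits refer to the 3-dimensional generic rigidity matroid $\mathcal{R}_3$ (a graph is identified with its edge set). $G$ is independent if $\mathrm{rank}(G)=|E(G)|$, dependent otherwise; rigid if its rank equals that of the complete graph on $V(G)$ ($=3|V(G)|-6$ when $|V(G)|\ge 3$). $G\cup f$ denotes $G$ with the pair $f$ added as an edge. A nonedge $f$ of $G$ is implied if $G\cup f$ contains a circuit containing $f$. A nucleation is a rigid subgraph on at least $5$ vertices; nucleation-free means having none. $G_1\cup G_2$ is the graph with vertex set $V(G_1)\cup V(G_2)$ and edge set $E(G_1)\cup E(G_2)$. -}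

module Defs where

open import Data.Nat using (ℕ; zero; suc; _≤_) renaming (_+_ to _+ℕ_; _<?_ to _<ℕ?_)
open import Data.Fin using (Fin; zero; suc; toℕ; _≟_)
open import Data.Bool using (Bool; true; false; _∨_; _∧_; not; if_then_else_)
open import Data.Rational using (ℚ; 0ℚ; _+_; _*_; _-_)
open import Data.Product using (Σ; _×_; _,_)
open import Data.Sum using (_⊎_)
open import Relation.Nullary using (¬_; ⌊_⌋)
open import Relation.Binary.PropositionalEquality using (_≡_; _≢_)

-- Graphs live on an ambient finite vertex universe Fin n.
-- A vertex set is a Boolean predicate on Fin n; an edge set is a Boolean
-- relation on Fin n, of which only the entries (u , v) with u < v are read
-- (so an edge set is a set of unordered pairs).
VSet : ℕ → Set
VSet n = Fin n → Bool

EdgeSet : ℕ → Set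
EdgeSet n = Fin n → Fin n → Bool

isPair : ∀ {n} → EdgeSet n → Fin n → Fin n → Bool
isPair E u v = E u v ∧ ⌊ toℕ u <ℕ? toℕ v ⌋

hasPair : ∀ {n} → EdgeSet n → Fin n → Fin n → Set
hasPair E u v = (isPair E u v ∨ isPair E v u) ≡ true

record IsGraph {n : ℕ} (V : VSet n) (E : EdgeSet n) : Set where
  field
    sym    : ∀ u v → E u v ≡ E v u
    irrefl : ∀ v → E v v ≡ false
    closed : ∀ u v → E u v ≡ true → V u ≡ true

Σℚ : ∀ {m} → (Fin m → ℚ) → ℚ
Σℚ {zero}  f = 0ℚ
Σℚ {suc m} f = f zero + Σℚ (λ i → f (suc i))

Σℕ : ∀ {m} → (Fin m → ℕ) → ℕ
Σℕ {zero}  f = 0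
Σℕ {suc m} f = f zero +ℕ Σℕ (λ i → f (suc i))

Realization : ℕ → Set
Realization n = Fin n → Fin 3 → ℚ

-- entry of the rigidity matrix R(G,p): row of the pair (u , v), column (w , k)
rigEntry : ∀ {n} → Realization n → Fin n → Fin n → Fin n → Fin 3 → ℚ
rigEntry p u v w k =
  if ⌊ w ≟ u ⌋ then p u k - p v k
  else if ⌊ w ≟ v ⌋ then p v k - p u k
  else 0ℚ

RowsIndependent : ∀ {n} → Realization n → EdgeSet n → Set
RowsIndependent {n} p E =
  (c : Fin n → Fin n → ℚ) →
  (∀ (w : Fin n) (k : Fin 3) →
     Σℚ (λ u → Σℚ (λ v → if isPair E u v then c u v * rigEntry p u v w k else 0ℚ)) ≡ 0ℚ) →
  ∀ u v → isPair E u v ≡ true → c u v ≡ 0ℚ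

-- independence in the generic 3-dimensional rigidity matroid:
-- the rigidity matrix has independent rows at some (equivalently, at a generic)
-- realization; rational realizations suffice since Q^{3n} is Zariski dense.
Independent : ∀ {n} → EdgeSet n → Set
Independent {n} E = Σ (Realization n) λ p → RowsIndependent p E

Dependent : ∀ {n} → EdgeSet n → Set
Dependent E = ¬ Independent E

_⊆E_ : ∀ {n} → EdgeSet n → EdgeSet n → Set
F ⊆E E = ∀ u v → isPair F u v ≡ true → isPair E u v ≡ true

countE : ∀ {n} → EdgeSet n → ℕ
countE E = Σℕ (λ u → Σℕ (λ v → if isPair E u v then 1 else 0))

countV : ∀ {n} → VSet n → ℕ
countV V = Σℕ (λ v → if V v then 1 else 0)

IsRank : ∀ {n} → EdgeSet n → ℕ → Set
IsRank {n} E r =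
  Σ (EdgeSet n) (λ F → F ⊆E E × Independent F × countE F ≡ r)
  × (∀ F → F ⊆E E → Independent F → countE F ≤ r)

K : ∀ {n} → VSet n → EdgeSet n
K V u v = V u ∧ V v ∧ not ⌊ u ≟ v ⌋

Rigid : ∀ {n} → VSet n → EdgeSet n → Set
Rigid V E = Σ ℕ λ r → IsRank E r × IsRank (K V) r

Nucleation : ∀ {n} → VSet n → EdgeSet n → Set
Nucleation {n} V E =
  Σ (VSet n) λ W → Σ (EdgeSet n) λ F →
    (∀ v → W v ≡ true → V v ≡ true) × F ⊆E E
    × (∀ u v → isPair F u v ≡ true → (W u ≡ true × W v ≡ true))
    × 5 ≤ countV W × Rigid W F

NucleationFree : ∀ {n} → VSet n → EdgeSet n → Set
NucleationFree V E = ¬ Nucleation V E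

Circuit : ∀ {n} → EdgeSet n → Set
Circuit {n} E =
  Dependent E ×
  (∀ F → F ⊆E E → (Σ (Fin n) λ u → Σ (Fin n) λ v → isPair E u v ≡ true × isPair F u v ≡ false)
       → Independent F)

addEdge : ∀ {n} → EdgeSet n → Fin n → Fin n → EdgeSet n
addEdge E x y u v = E u v ∨ ((⌊ u ≟ x ⌋ ∧ ⌊ v ≟ y ⌋) ∨ (⌊ u ≟ y ⌋ ∧ ⌊ v ≟ x ⌋))

Nonedge : ∀ {n} → VSet n → EdgeSet n → Fin n → Fin n → Set
Nonedge V E x y = x ≢ y × V x ≡ true × V y ≡ true × E x y ≡ false

Implied : ∀ {n} → VSet n → EdgeSet n → Fin n → Fin n → Set
Implied {n} V E x y =
  Nonedge V E x y ×
  Σ (EdgeSet n) λ C → C ⊆E addEdge E x y × Circuit C × hasPair C x y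

_∪V_ : ∀ {n} → VSet n → VSet n → VSet n
(V₁ ∪V V₂) v = V₁ v ∨ V₂ v

_∪E_ : ∀ {n} → EdgeSet n → EdgeSet n → EdgeSet n
(E₁ ∪E E₂) u v = E₁ u v ∨ E₂ u v

EdgeDisjoint : ∀ {n} → EdgeSet n → EdgeSet n → Set
EdgeDisjoint E₁ E₂ = ∀ u v → isPair E₁ u v ≡ true → isPair E₂ u v ≡ false

InterIs : ∀ {n} → VSet n → VSet n → Fin n → Fin n → Set
InterIs V₁ V₂ x y =
  ∀ v → ((V₁ v ∧ V₂ v) ≡ true → (v ≡ x ⊎ v ≡ y)) × ((v ≡ x ⊎ v ≡ y) → (V₁ v ∧ V₂ v) ≡ true)

-- Independence at a realization persists under small perturbations of it, so x
-- and y may be put at 0 and e₀. For (ii), stresses of the two circuits combine so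
-- that f cancels. For (iii), realizations of the two sides are glued along x and
-- y: the load that one side exerts on the other is in equilibrium and concentrated
-- at x and y, hence a multiple of the row of f. For (i), if a nucleation had
-- vertices a and b strictly on the two sides, then rotating one side about the
-- line xy would show that ab can be added to any of its independent edge sets,
-- against rigidity; so it lies on one side, and no ranks need to be computed.

module Submission where

open import Defs
open import Data.Bool using (Bool; true; false; _∨_; _∧_; not; if_then_else_)
open import Data.Bool.Properties using (∧-comm; ¬-not) renaming (_≟_ to _≟ᵇ_)
open import Data.Empty using (⊥; ⊥-elim)
open import Data.Fin using (Fin; zero; suc; toℕ; _≟_; _↑ˡ_; _↑ʳ_; combine; remQuot; quotient; remainder)
open import Data.Fin.Properties using (remQuot-combine; combine-remQuot; any?; suc-injective; <-cmp)
open import Data.Nat using (ℕ; zero; suc; z≤n; _<_; _<?_) renaming (_+_ to _+ℕ_; _*_ to _*ℕ_; _≤_ to _≤ℕ_)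
open import Data.Nat.Properties as ℕ using (<-asym; <-irrefl)
open import Data.Product using (Σ; _×_; _,_; proj₁; proj₂)
open import Data.Product.Properties using (≡-dec)
open import Data.Rational using (ℚ; 0ℚ; 1ℚ; _+_; _*_; _-_; -_; _≤_; ∣_∣; 1/_; ≢-nonZero; NonZero)
open import Data.Rational.Properties renaming (_≟_ to _≟ℚ_) hiding (<-asym; <-irrefl; <-cmp; _<?_)
open import Data.Rational.Solver using (module +-*-Solver)
open import Data.Sum using (_⊎_; inj₁; inj₂; [_,_]′)
open import Data.Vec.Functional using (_∷_)
open import Function using (_∘_; id)
open import Relation.Binary.Definitions using (tri<; tri≈; tri>)
open import Relation.Nullary using (¬_; Dec; yes; no; ⌊_⌋; ¬?; _×-dec_; contradiction; decidable-stable)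
open import Relation.Binary.PropositionalEquality

open +-*-Solver using (solve; _:=_; _:+_; _:*_; _:-_; :-_; con)

-- Finite sums

-- Independence asks for one rational realization, and different edge sets may come with different
-- witnesses, so each argument must stay at one realization or bring its witnesses to a common one.
-- In place of a generic point, every degeneracy (the ends of `f` sharing a coordinate, a
-- tetrahedron of volume zero) is avoided by a perturbation of its own, made one after the other.
-- Its step size is a nonzero rational computed from a right inverse of the selected rows, so
-- neither limits nor polynomials occur. Dependence denies freeness at every realization, which
-- allows both circuits of (ii) to be tested at the very realization at which the union is supposed
-- independent. In (iii) the two realizations are unrelated; an invertible affine map, which
-- preserves independence, first makes them agree at the ends of `f`. Force balance, torque balance
-- and the hinge argument all come from one identity, the virtual work of a load against a velocity.

Σ-cong : ∀ {m} {f g : Fin m → ℚ} → (∀ i → f i ≡ g i) → Σℚ f ≡ Σℚ g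
Σ-cong {zero}  f≡g = refl
Σ-cong {suc m} f≡g = cong₂ _+_ (f≡g zero) (Σ-cong (f≡g ∘ suc))

Σ-zero : ∀ {m} {f : Fin m → ℚ} → (∀ i → f i ≡ 0ℚ) → Σℚ f ≡ 0ℚ
Σ-zero {zero}  f≡0 = refl
Σ-zero {suc m} f≡0 = cong₂ _+_ (f≡0 zero) (Σ-zero (f≡0 ∘ suc))

Σ-+ : ∀ {m} (f g : Fin m → ℚ) → Σℚ (λ i → f i + g i) ≡ Σℚ f + Σℚ g
Σ-+ {zero}  f g = refl
Σ-+ {suc m} f g = trans (cong (f zero + g zero +_) (Σ-+ (f ∘ suc) (g ∘ suc)))
  (solve 4 (λ a b c d → (a :+ b) :+ (c :+ d) := (a :+ c) :+ (b :+ d)) refl (f zero) (g zero) (Σℚ (f ∘ suc)) (Σℚ (g ∘ suc)))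

Σ-*ˡ : ∀ {m} a (f : Fin m → ℚ) → Σℚ (λ i → a * f i) ≡ a * Σℚ f
Σ-*ˡ {zero}  a f = sym (*-zeroʳ a)
Σ-*ˡ {suc m} a f = trans (cong (a * f zero +_) (Σ-*ˡ a (f ∘ suc))) (sym (*-distribˡ-+ a _ _))

Σ-*ʳ : ∀ {m} (f : Fin m → ℚ) a → Σℚ (λ i → f i * a) ≡ Σℚ f * a
Σ-*ʳ f a = trans (Σ-cong (λ i → *-comm (f i) a)) (trans (Σ-*ˡ a f) (*-comm a _))

Σ-linear : ∀ {m} a b (f g : Fin m → ℚ) →
  Σℚ (λ i → a * f i + b * g i) ≡ a * Σℚ f + b * Σℚ g
Σ-linear a b f g =
  trans (Σ-+ (λ i → a * f i) (λ i → b * g i)) (cong₂ _+_ (Σ-*ˡ a f) (Σ-*ˡ b g))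

Σ-swap : ∀ {m n} (f : Fin m → Fin n → ℚ) →
  Σℚ (λ i → Σℚ (f i)) ≡ Σℚ (λ j → Σℚ (λ i → f i j))
Σ-swap {zero} {n} f = sym (Σ-zero {n} {λ _ → 0ℚ} (λ _ → refl))
Σ-swap {suc m} f = trans (cong (Σℚ (f zero) +_) (Σ-swap (f ∘ suc))) (sym (Σ-+ (f zero) _))

Σ-single : ∀ {m} (f : Fin m → ℚ) j → (∀ i → i ≢ j → f i ≡ 0ℚ) → Σℚ f ≡ f j
Σ-single f zero    off =
  trans (cong (f zero +_) (Σ-zero (λ i → off (suc i) λ ()))) (+-identityʳ (f zero))
Σ-single f (suc j) off =
  trans (cong₂ _+_ (off zero λ ()) (Σ-single (f ∘ suc) j (λ i i≢j → off (suc i) (i≢j ∘ suc-injective))))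
        (+-identityˡ (f (suc j)))

Σ-↑ : ∀ a {b} (f : Fin (a +ℕ b) → ℚ) → Σℚ f ≡ Σℚ (λ i → f (i ↑ˡ b)) + Σℚ (λ i → f (a ↑ʳ i))
Σ-↑ zero    f = sym (+-identityˡ _)
Σ-↑ (suc a) f = trans (cong (f zero +_) (Σ-↑ a (f ∘ suc))) (sym (+-assoc (f zero) _ _))

Σ-combine : ∀ {m n} (f : Fin (m *ℕ n) → ℚ) → Σℚ f ≡ Σℚ (λ u → Σℚ (λ v → f (combine {m} {n} u v)))
Σ-combine {zero}      f = refl
Σ-combine {suc m} {n} f = trans (Σ-↑ n f)
  (cong (Σℚ (λ i → f (i ↑ˡ (m *ℕ n))) +_) (Σ-combine {m} {n} (f ∘ (n ↑ʳ_))))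

Σ-remQuot : ∀ {m n} (f : Fin m → Fin n → ℚ) →
  Σℚ (λ (i : Fin (m *ℕ n)) → f (proj₁ (remQuot {m} n i)) (proj₂ (remQuot {m} n i))) ≡ Σℚ (λ u → Σℚ (f u))
Σ-remQuot {m} {n} f = trans (Σ-combine {m} {n} (λ i → f (proj₁ (remQuot {m} n i)) (proj₂ (remQuot {m} n i))))
  (Σ-cong (λ u → Σ-cong (λ v → cong (λ r → f (proj₁ r) (proj₂ r)) (remQuot-combine {m} {n} u v))))

Σ-mono : ∀ {m} {f g : Fin m → ℚ} → (∀ i → f i ≤ g i) → Σℚ f ≤ Σℚ g
Σ-mono {zero}  f≤g = ≤-refl
Σ-mono {suc m} f≤g = +-mono-≤ (f≤g zero) (Σ-mono (f≤g ∘ suc))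

Σ-nonNeg : ∀ {m} {f : Fin m → ℚ} → (∀ i → 0ℚ ≤ f i) → 0ℚ ≤ Σℚ f
Σ-nonNeg {m} {f} 0≤f = subst (_≤ Σℚ f) (Σ-zero {m} {λ _ → 0ℚ} (λ _ → refl)) (Σ-mono 0≤f)

term≤Σ : ∀ {m} {f : Fin m → ℚ} → (∀ i → 0ℚ ≤ f i) → ∀ i → f i ≤ Σℚ f
term≤Σ {f = f} 0≤f zero    = subst (_≤ Σℚ f) (+-identityʳ (f zero)) (+-monoʳ-≤ (f zero) (Σ-nonNeg (0≤f ∘ suc)))
term≤Σ {f = f} 0≤f (suc i) = subst (_≤ Σℚ f) (+-identityˡ (f (suc i))) (+-mono-≤ (0≤f zero) (term≤Σ (0≤f ∘ suc) i))

∣Σ∣≤Σ∣∣ : ∀ {m} (f : Fin m → ℚ) → ∣ Σℚ f ∣ ≤ Σℚ (λ i → ∣ f i ∣)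
∣Σ∣≤Σ∣∣ {zero}  f = ≤-refl
∣Σ∣≤Σ∣∣ {suc m} f = ≤-trans (∣p+q∣≤∣p∣+∣q∣ (f zero) _) (+-monoʳ-≤ ∣ f zero ∣ (∣Σ∣≤Σ∣∣ (f ∘ suc)))

δ : ∀ {m} → Fin m → Fin m → ℚ
δ i j = if ⌊ i ≟ j ⌋ then 1ℚ else 0ℚ

δ-refl : ∀ {m} (i : Fin m) → δ i i ≡ 1ℚ
δ-refl i with i ≟ i
... | yes _   = refl
... | no  i≢i = contradiction refl i≢i

δ-≢ : ∀ {m} {i j : Fin m} → i ≢ j → δ i j ≡ 0ℚ
δ-≢ {i = i} {j} i≢j with i ≟ j
... | yes i≡j = contradiction i≡j i≢j
... | no  _   = refl

Σ-δ : ∀ {m} (f : Fin m → ℚ) j → Σℚ (λ i → f i * δ i j) ≡ f j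
Σ-δ f j = trans (Σ-single _ j (λ i i≢j → trans (cong (f i *_) (δ-≢ i≢j)) (*-zeroʳ (f i))))
                (trans (cong (f j *_) (δ-refl j)) (*-identityʳ (f j)))

no-zero-divisors : ∀ {a b} → a * b ≡ 0ℚ → a ≢ 0ℚ → b ≡ 0ℚ
no-zero-divisors {a} {b} ab≡0 a≢0 = begin
  b                ≡⟨ *-identityˡ b ⟨
  1ℚ * b           ≡⟨ cong (_* b) (*-inverseˡ a) ⟨
  1/ a * a * b     ≡⟨ *-assoc (1/ a) a b ⟩
  1/ a * (a * b)   ≡⟨ cong (1/ a *_) ab≡0 ⟩
  1/ a * 0ℚ        ≡⟨ *-zeroʳ (1/ a) ⟩
  0ℚ               ∎
  where
  open ≡-Reasoning
  instance nz : NonZero a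
           nz = ≢-nonZero a≢0

inverse : ∀ {a} → a ≢ 0ℚ → Σ ℚ λ b → b * a ≡ 1ℚ
inverse {a} a≢0 = 1/ a , *-inverseˡ a
  where instance nz : NonZero a
                 nz = ≢-nonZero a≢0

-- Rows of a rational matrix

dot : ∀ {N} → (Fin N → ℚ) → (Fin N → ℚ) → ℚ
dot u v = Σℚ (λ x → u x * v x)

dot-linearˡ : ∀ {N} a b (u v z : Fin N → ℚ) →
  dot (λ x → a * u x + b * v x) z ≡ a * dot u z + b * dot v z
dot-linearˡ a b u v z = trans
  (Σ-cong (λ x → solve 5 (λ a b p q r → (a :* p :+ b :* q) :* r := a :* (p :* r) :+ b :* (q :* r)) refl a b (u x) (v x) (z x)))
  (Σ-linear a b (λ x → u x * z x) (λ x → v x * z x))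

dot-comm : ∀ {N} (u v : Fin N → ℚ) → dot u v ≡ dot v u
dot-comm u v = Σ-cong (λ x → *-comm (u x) (v x))

dot-linearʳ : ∀ {N} a b (z u v : Fin N → ℚ) →
  dot z (λ x → a * u x + b * v x) ≡ a * dot z u + b * dot z v
dot-linearʳ a b z u v = trans (dot-comm z _)
  (trans (dot-linearˡ a b u v z) (cong₂ (λ s t → a * s + b * t) (dot-comm u z) (dot-comm v z)))

dot-Σˡ : ∀ {m N} (c : Fin m → ℚ) (A : Fin m → Fin N → ℚ) (z : Fin N → ℚ) →
  dot (λ x → Σℚ (λ i → c i * A i x)) z ≡ Σℚ (λ i → c i * dot (A i) z)
dot-Σˡ c A z = begin
  Σℚ (λ x → Σℚ (λ i → c i * A i x) * z x)      ≡⟨ Σ-cong (λ x → Σ-*ʳ (λ i → c i * A i x) (z x)) ⟨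
  Σℚ (λ x → Σℚ (λ i → c i * A i x * z x))      ≡⟨ Σ-swap (λ x i → c i * A i x * z x) ⟩
  Σℚ (λ i → Σℚ (λ x → c i * A i x * z x))      ≡⟨ Σ-cong (λ i → Σ-cong (λ x → *-assoc (c i) (A i x) (z x))) ⟩
  Σℚ (λ i → Σℚ (λ x → c i * (A i x * z x)))    ≡⟨ Σ-cong (λ i → Σ-*ˡ (c i) (λ x → A i x * z x)) ⟩
  Σℚ (λ i → c i * dot (A i) z)                 ∎
  where open ≡-Reasoning

dot-zeroˡ : ∀ {N} {u : Fin N → ℚ} → (∀ x → u x ≡ 0ℚ) → ∀ z → dot u z ≡ 0ℚ
dot-zeroˡ u≡0 z = Σ-zero (λ x → trans (cong (_* z x) (u≡0 x)) (*-zeroˡ (z x)))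

-- A set of rows is a mask on a fixed index type, with coefficients that vanish off it. All edge
-- sets then share the index type of all pairs, and nothing is reindexed when edges are added or
-- deleted.
Supported : ∀ {m} → (Fin m → Bool) → (Fin m → ℚ) → Set
Supported b c = ∀ i → b i ≡ false → c i ≡ 0ℚ

RowsFree : ∀ {m N} → (Fin m → Bool) → (Fin m → Fin N → ℚ) → Set
RowsFree b A = ∀ c → Supported b c → (∀ x → Σℚ (λ i → c i * A i x) ≡ 0ℚ) → ∀ i → c i ≡ 0ℚ

-- The selected vectors of `B`, as columns, form a right inverse of the selected rows of `A`. Unlike
-- freeness this is explicit data, from which a safe step size can be computed.
DualTo : ∀ {m N} → (Fin m → Bool) → (Fin m → Fin N → ℚ) → (Fin m → Fin N → ℚ) → Set
DualTo b A B = ∀ i j → b i ≡ true → b j ≡ true → dot (A i) (B j) ≡ δ i j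

mask : Bool → ℚ → ℚ
mask b q = if b then q else 0ℚ

mask-false : ∀ {b} q → b ≡ false → mask b q ≡ 0ℚ
mask-false q refl = refl

mask-true : ∀ {b} q → b ≡ true → mask b q ≡ q
mask-true q refl = refl

δ-suc : ∀ {m} (i j : Fin m) → δ (suc i) (suc j) ≡ δ i j
δ-suc i j with i ≟ j
... | yes _ = refl
... | no  _ = refl

-- Gram–Schmidt: the first row minus its projection onto the others does not
-- vanish, so some column separates it from them.
dualBasis : ∀ {m N} (b : Fin m → Bool) (A : Fin m → Fin N → ℚ) →
  RowsFree b A → Σ (Fin m → Fin N → ℚ) (DualTo b A)
dualBasis {zero}  b A free = (λ ()) , λ ()
dualBasis {suc m} {N} b A free with dualBasis (b ∘ suc) (A ∘ suc) tailFree
  where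
  tailFree : RowsFree (b ∘ suc) (A ∘ suc)
  tailFree c off rel i = free (0ℚ ∷ c)
    (λ { zero _ → refl ; (suc i) → off i })
    (λ x → trans (cong (_+ Σℚ (λ j → c j * A (suc j) x)) (*-zeroˡ (A zero x))) (trans (+-identityˡ _) (rel x)))
    (suc i)
... | B , dual with b zero in b₀
...   | false = (λ _ → 0ℚ) ∷ B , λ
  { zero    j       bi _  → contradiction (trans (sym bi) b₀) λ ()
  ; (suc i) zero    _  bj → contradiction (trans (sym bj) b₀) λ ()
  ; (suc i) (suc j) bi bj → trans (dual i j bi bj) (sym (δ-suc i j)) }
...   | true with any? (λ x → ¬? (A zero x - Σℚ (λ j → mask (b (suc j)) (dot (A zero) (B j)) * A (suc j) x) ≟ℚ 0ℚ))
...     | no ¬sep = contradiction (free c (λ { zero b₀≡f → contradiction (trans (sym b₀) b₀≡f) λ ()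
                                            ; (suc j) bj → cong (-_) (mask-false _ bj) }) relation zero) λ ()
  where
  α : Fin m → ℚ
  α j = mask (b (suc j)) (dot (A zero) (B j))
  -- If no column separates, the first row equals its projection; in this relation the leading
  -- coefficient is 1, which freeness would make 0.
  c : Fin (suc m) → ℚ
  c = 1ℚ ∷ (λ j → - α j)
  relation : ∀ x → Σℚ (λ i → c i * A i x) ≡ 0ℚ
  relation x = begin
    1ℚ * A zero x + Σℚ (λ j → - α j * A (suc j) x)
      ≡⟨ cong (1ℚ * A zero x +_) (Σ-cong (λ j → solve 2 (λ a r → :- a :* r := con (- 1ℚ) :* (a :* r)) refl (α j) (A (suc j) x))) ⟩
    1ℚ * A zero x + Σℚ (λ j → - 1ℚ * (α j * A (suc j) x))
      ≡⟨ cong (1ℚ * A zero x +_) (Σ-*ˡ (- 1ℚ) (λ j → α j * A (suc j) x)) ⟩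
    1ℚ * A zero x + - 1ℚ * Σℚ (λ j → α j * A (suc j) x)
      ≡⟨ solve 2 (λ a s → con 1ℚ :* a :+ con (- 1ℚ) :* s := a :- s) refl (A zero x) _ ⟩
    A zero x - Σℚ (λ j → α j * A (suc j) x)
      ≡⟨ decidable-stable (_ ≟ℚ 0ℚ) (λ ≢0 → ¬sep (x , ≢0)) ⟩
    0ℚ ∎
    where open ≡-Reasoning
...     | yes (x₀ , ρ≢0) = v ∷ B′ , λ
  { zero    zero    _  _  → trans A₀v (sym (δ-refl {suc m} zero))
  ; zero    (suc j) _  bj → trans (split zero j) (trans
      (cong (λ s → 1ℚ * dot (A zero) (B j) + - dot (A zero) (B j) * s) A₀v)
      (solve 1 (λ d → con 1ℚ :* d :+ :- d :* con 1ℚ := con 0ℚ) refl (dot (A zero) (B j))))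
  ; (suc i) zero    bi _  → Aᵢv i bi
  ; (suc i) (suc j) bi bj → trans (split (suc i) j) (trans
      (cong₂ (λ s t → 1ℚ * s + - dot (A zero) (B j) * t) (trans (dual i j bi bj) (sym (δ-suc i j))) (Aᵢv i bi))
      (solve 2 (λ e d → con 1ℚ :* e :+ :- d :* con 0ℚ := e) refl (δ (suc i) (suc j)) (dot (A zero) (B j)))) }
  where
  open ≡-Reasoning
  ρ = A zero x₀ - Σℚ (λ j → mask (b (suc j)) (dot (A zero) (B j)) * A (suc j) x₀)
  ρ⁻¹ = proj₁ (inverse ρ≢0)
  a : Fin m → ℚ
  a j = mask (b (suc j)) (A (suc j) x₀)
  -- Pairing with `δ x x₀` reads column `x₀`. The sum cancels that reading on every later selected
  -- row and leaves `ρ` on the first one, whence the factor `ρ⁻¹`; `B′` then uses `v` to clear the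
  -- first row from the old dual vectors.
  v : Fin N → ℚ
  v x = ρ⁻¹ * δ x x₀ + - ρ⁻¹ * Σℚ (λ j → a j * B j x)
  B′ : Fin m → Fin N → ℚ
  B′ j x = 1ℚ * B j x + - dot (A zero) (B j) * v x
  split : ∀ i j → dot (A i) (B′ j) ≡ 1ℚ * dot (A i) (B j) + - dot (A zero) (B j) * dot (A i) v
  split i j = dot-linearʳ 1ℚ (- dot (A zero) (B j)) (A i) (B j) v
  Av : ∀ i → dot (A i) v ≡ ρ⁻¹ * A i x₀ + - ρ⁻¹ * Σℚ (λ j → a j * dot (A i) (B j))
  Av i = begin
    dot (A i) v
      ≡⟨ dot-linearʳ ρ⁻¹ (- ρ⁻¹) (A i) (λ x → δ x x₀) (λ x → Σℚ (λ j → a j * B j x)) ⟩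
    ρ⁻¹ * dot (A i) (λ x → δ x x₀) + - ρ⁻¹ * dot (A i) (λ x → Σℚ (λ j → a j * B j x))
      ≡⟨ cong₂ (λ s t → ρ⁻¹ * s + - ρ⁻¹ * t) (Σ-δ (A i) x₀)
               (trans (dot-comm (A i) _) (trans (dot-Σˡ a B (A i)) (Σ-cong (λ j → cong (a j *_) (dot-comm (B j) (A i)))))) ⟩
    ρ⁻¹ * A i x₀ + - ρ⁻¹ * Σℚ (λ j → a j * dot (A i) (B j)) ∎
  transfer : ∀ c p q → mask c p * q ≡ mask c q * p
  transfer true  p q = *-comm p q
  transfer false p q = trans (*-zeroˡ q) (sym (*-zeroˡ p))
  A₀v : dot (A zero) v ≡ 1ℚ
  A₀v = begin
    dot (A zero) v
      ≡⟨ Av zero ⟩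
    ρ⁻¹ * A zero x₀ + - ρ⁻¹ * Σℚ (λ j → a j * dot (A zero) (B j))
      ≡⟨ cong (λ s → ρ⁻¹ * A zero x₀ + - ρ⁻¹ * s) (Σ-cong (λ j → transfer (b (suc j)) _ _)) ⟩
    ρ⁻¹ * A zero x₀ + - ρ⁻¹ * Σℚ (λ j → mask (b (suc j)) (dot (A zero) (B j)) * A (suc j) x₀)
      ≡⟨ solve 3 (λ r p s → r :* p :+ :- r :* s := r :* (p :- s)) refl ρ⁻¹ (A zero x₀) _ ⟩
    ρ⁻¹ * ρ
      ≡⟨ proj₂ (inverse ρ≢0) ⟩
    1ℚ ∎
  reproduce : ∀ i → b (suc i) ≡ true → ∀ j → a j * dot (A (suc i)) (B j) ≡ a j * δ j i
  reproduce i bi j with b (suc j) in bj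
  ... | false = trans (*-zeroˡ (dot (A (suc i)) (B j))) (sym (*-zeroˡ (δ j i)))
  ... | true  = cong (A (suc j) x₀ *_) (trans (dual i j bi bj) (δ-sym i j))
    where
    δ-sym : ∀ {m} (i j : Fin m) → δ i j ≡ δ j i
    δ-sym i j with i ≟ j
    ... | yes refl = sym (δ-refl i)
    ... | no  i≢j  = sym (δ-≢ (i≢j ∘ sym))
  Aᵢv : ∀ i → b (suc i) ≡ true → dot (A (suc i)) v ≡ 0ℚ
  Aᵢv i bi = begin
    dot (A (suc i)) v
      ≡⟨ Av (suc i) ⟩
    ρ⁻¹ * A (suc i) x₀ + - ρ⁻¹ * Σℚ (λ j → a j * dot (A (suc i)) (B j))
      ≡⟨ cong (λ s → ρ⁻¹ * A (suc i) x₀ + - ρ⁻¹ * s)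
              (trans (Σ-cong (reproduce i bi)) (trans (Σ-δ a i) (mask-true _ bi))) ⟩
    ρ⁻¹ * A (suc i) x₀ + - ρ⁻¹ * A (suc i) x₀
      ≡⟨ solve 2 (λ r p → r :* p :+ :- r :* p := con 0ℚ) refl ρ⁻¹ (A (suc i) x₀) ⟩
    0ℚ ∎

dot-shift : ∀ {N} t (u v z : Fin N → ℚ) →
  dot (λ x → u x + t * v x) z ≡ dot u z + t * dot v z
dot-shift t u v z = trans
  (Σ-cong (λ x → cong (λ p → (p + t * v x) * z x) (sym (*-identityˡ (u x)))))
  (trans (dot-linearˡ 1ℚ t u v z) (cong (_+ t * dot v z) (*-identityˡ (dot u z))))

-- With B dual to the rows of A, a relation c among the rows of A + t S satisfies
-- c + t c (S B) = 0, which forces c = 0 once t times the norm of S B is below 1.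
perturbRows : ∀ {m N} (b : Fin m → Bool) (A S : Fin m → Fin N → ℚ) → RowsFree b A →
  Σ ℚ λ t → t ≢ 0ℚ × RowsFree b (λ i x → A i x + t * S i x)
perturbRows {m} {N} b A S free with dualBasis b A free
... | B , dual = t , t≢0 , λ c off rel j → ∣p∣≡0⇒p≡0 (c j)
      (≤-antisym (≤-trans (term≤Σ (λ i → 0≤∣p∣ (c i)) j) (mass≤0 c off rel)) (0≤∣p∣ (c j)))
  where
  open ≤-Reasoning
  M : Fin m → Fin m → ℚ
  M i j = dot (S i) (B j)
  κ = Σℚ (λ i → Σℚ (λ j → ∣ M i j ∣))
  row≤κ : ∀ i → Σℚ (λ j → ∣ M i j ∣) ≤ κ
  row≤κ = term≤Σ (λ i → Σ-nonNeg (λ j → 0≤∣p∣ (M i j)))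
  0≤κ : 0ℚ ≤ κ
  0≤κ = Σ-nonNeg (λ i → Σ-nonNeg (λ j → 0≤∣p∣ (M i j)))
  1≤1+κ : 1ℚ ≤ 1ℚ + κ
  1≤1+κ = subst (_≤ 1ℚ + κ) (+-identityʳ 1ℚ) (+-monoʳ-≤ 1ℚ 0≤κ)
  0≤1+κ : 0ℚ ≤ 1ℚ + κ
  0≤1+κ = +-mono-≤ (0≤∣p∣ 1ℚ) 0≤κ
  1+κ≢0 : 1ℚ + κ ≢ 0ℚ
  1+κ≢0 ≡0 = contradiction (≤-antisym (subst (1ℚ ≤_) ≡0 1≤1+κ) (0≤∣p∣ 1ℚ)) λ ()
  -- Any denominator above `κ` would make the perturbation contract; adding 1 also covers `κ` equal
  -- to zero.
  t = proj₁ (inverse 1+κ≢0)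
  t≢0 : t ≢ 0ℚ
  t≢0 t≡0 = contradiction
    (trans (sym (proj₂ (inverse 1+κ≢0))) (trans (cong (_* (1ℚ + κ)) t≡0) (*-zeroˡ (1ℚ + κ)))) λ ()
  module _ (c : Fin m → ℚ) (off : Supported b c)
           (rel : ∀ x → Σℚ (λ i → c i * (A i x + t * S i x)) ≡ 0ℚ) where
    X : Fin m → ℚ
    X j = Σℚ (λ i → c i * M i j)
    diagonal : ∀ j → b j ≡ true → ∀ i → c i * dot (A i) (B j) ≡ c i * δ i j
    diagonal j bj i with b i in bi
    ... | true  = cong (c i *_) (dual i j bi bj)
    ... | false rewrite off i bi = trans (*-zeroˡ (dot (A i) (B j))) (sym (*-zeroˡ (δ i j)))
    fixedPoint : ∀ j → b j ≡ true → c j + t * X j ≡ 0ℚ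
    fixedPoint j bj = begin-equality
      c j + t * X j
        ≡⟨ cong₂ _+_ (Σ-δ c j) (Σ-*ˡ t (λ i → c i * M i j)) ⟨
      Σℚ (λ i → c i * δ i j) + Σℚ (λ i → t * (c i * M i j))
        ≡⟨ Σ-+ (λ i → c i * δ i j) (λ i → t * (c i * M i j)) ⟨
      Σℚ (λ i → c i * δ i j + t * (c i * M i j))
        ≡⟨ Σ-cong (λ i → trans (cong (_+ t * (c i * M i j)) (sym (diagonal j bj i)))
             (trans (solve 4 (λ t c p q → c :* p :+ t :* (c :* q) := c :* (p :+ t :* q)) refl
                       t (c i) (dot (A i) (B j)) (M i j))
                    (cong (c i *_) (sym (dot-shift t (A i) (S i) (B j)))))) ⟩
      Σℚ (λ i → c i * dot (λ x → A i x + t * S i x) (B j))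
        ≡⟨ dot-Σˡ c (λ i x → A i x + t * S i x) (B j) ⟨
      dot (λ x → Σℚ (λ i → c i * (A i x + t * S i x))) (B j)
        ≡⟨ dot-zeroˡ rel (B j) ⟩
      0ℚ ∎
    scaled : ∀ j → b j ≡ true → (1ℚ + κ) * c j ≡ - X j
    scaled j bj = begin-equality
      (1ℚ + κ) * c j
        ≡⟨ solve 4 (λ k c t x → k :* c := k :* (c :+ t :* x) :- (t :* k) :* x) refl (1ℚ + κ) (c j) t (X j) ⟩
      (1ℚ + κ) * (c j + t * X j) - t * (1ℚ + κ) * X j
        ≡⟨ cong₂ (λ p q → (1ℚ + κ) * p - q * X j) (fixedPoint j bj) (proj₂ (inverse 1+κ≢0)) ⟩
      (1ℚ + κ) * 0ℚ - 1ℚ * X j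
        ≡⟨ solve 2 (λ k x → k :* con 0ℚ :- con 1ℚ :* x := :- x) refl (1ℚ + κ) (X j) ⟩
      - X j ∎
    entry≤ : ∀ j → (1ℚ + κ) * ∣ c j ∣ ≤ Σℚ (λ i → ∣ c i ∣ * ∣ M i j ∣)
    entry≤ j with b j in bj
    ... | true = begin
      (1ℚ + κ) * ∣ c j ∣                ≡⟨ cong (_* ∣ c j ∣) (0≤p⇒∣p∣≡p 0≤1+κ) ⟨
      ∣ 1ℚ + κ ∣ * ∣ c j ∣              ≡⟨ ∣p*q∣≡∣p∣*∣q∣ (1ℚ + κ) (c j) ⟨
      ∣ (1ℚ + κ) * c j ∣                ≡⟨ cong ∣_∣ (scaled j bj) ⟩
      ∣ - X j ∣                         ≡⟨ ∣-p∣≡∣p∣ (X j) ⟩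
      ∣ X j ∣                           ≤⟨ ∣Σ∣≤Σ∣∣ (λ i → c i * M i j) ⟩
      Σℚ (λ i → ∣ c i * M i j ∣)        ≡⟨ Σ-cong (λ i → ∣p*q∣≡∣p∣*∣q∣ (c i) (M i j)) ⟩
      Σℚ (λ i → ∣ c i ∣ * ∣ M i j ∣)    ∎
    ... | false = begin
      (1ℚ + κ) * ∣ c j ∣                ≡⟨ cong (λ p → (1ℚ + κ) * ∣ p ∣) (off j bj) ⟩
      (1ℚ + κ) * 0ℚ                     ≡⟨ *-zeroʳ (1ℚ + κ) ⟩
      0ℚ                                ≤⟨ Σ-nonNeg (λ i → subst (0ℚ ≤_) (∣p*q∣≡∣p∣*∣q∣ (c i) (M i j)) (0≤∣p∣ (c i * M i j))) ⟩
      Σℚ (λ i → ∣ c i ∣ * ∣ M i j ∣)    ∎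
    T = Σℚ (λ j → ∣ c j ∣)
    -- Summing over `j` and exchanging the sums turns the column bounds into row sums of `M`, each
    -- at most `κ`.
    bound : (1ℚ + κ) * T ≤ T * κ
    bound = begin
      (1ℚ + κ) * T                               ≡⟨ Σ-*ˡ (1ℚ + κ) (λ j → ∣ c j ∣) ⟨
      Σℚ (λ j → (1ℚ + κ) * ∣ c j ∣)              ≤⟨ Σ-mono entry≤ ⟩
      Σℚ (λ j → Σℚ (λ i → ∣ c i ∣ * ∣ M i j ∣))  ≡⟨ Σ-swap (λ i j → ∣ c i ∣ * ∣ M i j ∣) ⟨
      Σℚ (λ i → Σℚ (λ j → ∣ c i ∣ * ∣ M i j ∣))  ≡⟨ Σ-cong (λ i → Σ-*ˡ ∣ c i ∣ (λ j → ∣ M i j ∣)) ⟩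
      Σℚ (λ i → ∣ c i ∣ * Σℚ (λ j → ∣ M i j ∣))  ≤⟨ Σ-mono (λ i → *-monoˡ-≤-nonNeg ∣ c i ∣ {{∣-∣-nonNeg (c i)}} (row≤κ i)) ⟩
      Σℚ (λ i → ∣ c i ∣ * κ)                     ≡⟨ Σ-*ʳ (λ i → ∣ c i ∣) κ ⟩
      T * κ                                      ∎
    mass≤0 : T ≤ 0ℚ
    mass≤0 = begin
      T                          ≡⟨ solve 2 (λ k T → T := (con 1ℚ :+ k) :* T :- T :* k) refl κ T ⟩
      (1ℚ + κ) * T - T * κ       ≤⟨ +-monoˡ-≤ (- (T * κ)) bound ⟩
      T * κ - T * κ              ≡⟨ +-inverseʳ (T * κ) ⟩
      0ℚ                         ∎

-- Stresses and their loads

ΣΣ : ∀ {n} → (Fin n → Fin n → ℚ) → ℚ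
ΣΣ f = Σℚ (λ u → Σℚ (f u))

ΣΣ-cong : ∀ {n} {f g : Fin n → Fin n → ℚ} → (∀ u v → f u v ≡ g u v) → ΣΣ f ≡ ΣΣ g
ΣΣ-cong f≡g = Σ-cong (λ u → Σ-cong (f≡g u))

ΣΣ-zero : ∀ {n} {f : Fin n → Fin n → ℚ} → (∀ u v → f u v ≡ 0ℚ) → ΣΣ f ≡ 0ℚ
ΣΣ-zero f≡0 = Σ-zero (λ u → Σ-zero (f≡0 u))

ΣΣ-linear : ∀ {n} a b (f g : Fin n → Fin n → ℚ) →
  ΣΣ (λ u v → a * f u v + b * g u v) ≡ a * ΣΣ f + b * ΣΣ g
ΣΣ-linear a b f g = trans (Σ-cong (λ u → Σ-linear a b (f u) (g u)))
                          (Σ-linear a b (λ u → Σℚ (f u)) (λ u → Σℚ (g u)))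

ΣΣ-single : ∀ {n} (f : Fin n → Fin n → ℚ) s t →
  (∀ u v → (u , v) ≢ (s , t) → f u v ≡ 0ℚ) → ΣΣ f ≡ f s t
ΣΣ-single f s t off =
  trans (Σ-single (λ u → Σℚ (f u)) s (λ u u≢s → Σ-zero (λ v → off u v (u≢s ∘ cong proj₁))))
        (Σ-single (f s) t (λ v v≢t → off s v (v≢t ∘ cong proj₂)))

Stress : ℕ → Set
Stress n = Fin n → Fin n → ℚ

load : ∀ {n} → Realization n → Stress n → Fin n → Fin 3 → ℚ
load p c w k = ΣΣ (λ u v → c u v * rigEntry p u v w k)

On : ∀ {n} → EdgeSet n → Stress n → Set
On E c = ∀ u v → isPair E u v ≡ false → c u v ≡ 0ℚ

-- The edge set restricts the coefficients instead of masking the summands, so `load` does not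
-- mention it and stays linear while stresses move between edge sets.
Free : ∀ {n} → Realization n → EdgeSet n → Set
Free p E = ∀ c → On E c → (∀ w k → load p c w k ≡ 0ℚ) → ∀ u v → c u v ≡ 0ℚ

if-on : ∀ {b} c r → (b ≡ false → c ≡ 0ℚ) → (if b then c * r else 0ℚ) ≡ c * r
if-on {true}  c r off = refl
if-on {false} c r off = sym (trans (cong (_* r) (off refl)) (*-zeroˡ r))

mask-* : ∀ b c r → mask b c * r ≡ (if b then c * r else 0ℚ)
mask-* true  c r = refl
mask-* false c r = *-zeroˡ r

rows⇒free : ∀ {n} {p : Realization n} {E} → RowsIndependent p E → Free p E
rows⇒free {p = p} {E} rows c on eq u v with isPair E u v in uv
... | true  = rows c (λ w k → trans (ΣΣ-cong (λ u v → if-on (c u v) (rigEntry p u v w k) (on u v))) (eq w k)) u v uv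
... | false = on u v uv

free⇒rows : ∀ {n} {p : Realization n} {E} → Free p E → RowsIndependent p E
free⇒rows {p = p} {E} free c eq u v uv = trans (sym (mask-true (c u v) uv))
  (free (λ u v → mask (isPair E u v) (c u v)) (λ u v → mask-false (c u v))
    (λ w k → trans (ΣΣ-cong (λ u v → mask-* (isPair E u v) (c u v) (rigEntry p u v w k))) (eq w k)) u v)

-- Kronecker symbols replace the nested tests, so that sums collapse by `Σ-δ` and the rest is ring
-- algebra. The case `u` equal to `v` fits as well, since both sides vanish.
rigEntry-δ : ∀ {n} (p : Realization n) u v w k →
  rigEntry p u v w k ≡ (δ w u - δ w v) * (p u k - p v k)
rigEntry-δ p u v w k with w ≟ u | w ≟ v
... | yes refl | yes refl = solve 1 (λ a → a :- a := (con 1ℚ :- con 1ℚ) :* (a :- a)) refl (p w k)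
... | yes refl | no  _    = solve 2 (λ a b → a :- b := (con 1ℚ :- con 0ℚ) :* (a :- b)) refl (p w k) (p v k)
... | no  _    | yes refl = solve 2 (λ a b → b :- a := (con 0ℚ :- con 1ℚ) :* (a :- b)) refl (p u k) (p w k)
... | no  _    | no  _    = solve 2 (λ a b → con 0ℚ := (con 0ℚ :- con 0ℚ) :* (a :- b)) refl (p u k) (p v k)

-- The entries are linear in coordinate differences. Two realizations and two coordinates are
-- allowed in order to cover both perturbations (one coordinate of two realizations) and affine maps
-- (two coordinates of one).
rigEntry-combination : ∀ {n} (p q r : Realization n) a b k i j →
  (∀ u v → r u k - r v k ≡ a * (p u i - p v i) + b * (q u j - q v j)) →
  ∀ u v w → rigEntry r u v w k ≡ a * rigEntry p u v w i + b * rigEntry q u v w j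
rigEntry-combination p q r a b k i j rel u v w = begin
  rigEntry r u v w k
    ≡⟨ rigEntry-δ r u v w k ⟩
  (δ w u - δ w v) * (r u k - r v k)
    ≡⟨ cong ((δ w u - δ w v) *_) (rel u v) ⟩
  (δ w u - δ w v) * (a * (p u i - p v i) + b * (q u j - q v j))
    ≡⟨ solve 5 (λ d a b x y → d :* (a :* x :+ b :* y) := a :* (d :* x) :+ b :* (d :* y)) refl
         (δ w u - δ w v) a b (p u i - p v i) (q u j - q v j) ⟩
  a * ((δ w u - δ w v) * (p u i - p v i)) + b * ((δ w u - δ w v) * (q u j - q v j))
    ≡⟨ cong₂ (λ x y → a * x + b * y) (rigEntry-δ p u v w i) (rigEntry-δ q u v w j) ⟨
  a * rigEntry p u v w i + b * rigEntry q u v w j ∎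
  where open ≡-Reasoning

load-combination : ∀ {n} (p r : Realization n) c a b k i j →
  (∀ u v → r u k - r v k ≡ a * (p u i - p v i) + b * (p u j - p v j)) →
  ∀ w → load r c w k ≡ a * load p c w i + b * load p c w j
load-combination p r c a b k i j rel w = trans
  (ΣΣ-cong (λ u v → trans (cong (c u v *_) (rigEntry-combination p p r a b k i j rel u v w))
    (solve 5 (λ c a b x y → c :* (a :* x :+ b :* y) := a :* (c :* x) :+ b :* (c :* y)) refl
      (c u v) a b (rigEntry p u v w i) (rigEntry p u v w j))))
  (ΣΣ-linear a b (λ u v → c u v * rigEntry p u v w i) (λ u v → c u v * rigEntry p u v w j))

load-linear : ∀ {n} (p : Realization n) a b (c d : Stress n) w k →
  load p (λ u v → a * c u v + b * d u v) w k ≡ a * load p c w k + b * load p d w k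
load-linear p a b c d w k = trans
  (ΣΣ-cong (λ u v → solve 5 (λ a b c d r → (a :* c :+ b :* d) :* r := a :* (c :* r) :+ b :* (d :* r)) refl
    a b (c u v) (d u v) (rigEntry p u v w k)))
  (ΣΣ-linear a b (λ u v → c u v * rigEntry p u v w k) (λ u v → d u v * rigEntry p u v w k))

-- Virtual work of the k-th coordinate of the load against a velocity m in direction k.
work : ∀ {n} (p : Realization n) (c : Stress n) k (m : Fin n → ℚ) →
  Σℚ (λ w → load p c w k * m w) ≡ ΣΣ (λ u v → c u v * ((p u k - p v k) * (m u - m v)))
work p c k m = begin
  Σℚ (λ w → load p c w k * m w)
    ≡⟨ Σ-cong (λ w → trans (Σ-cong (λ u → Σ-*ʳ (λ v → c u v * rigEntry p u v w k) (m w)))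
                           (Σ-*ʳ (λ u → Σℚ (λ v → c u v * rigEntry p u v w k)) (m w))) ⟨
  Σℚ (λ w → ΣΣ (λ u v → c u v * rigEntry p u v w k * m w))
    ≡⟨ Σ-swap (λ w u → Σℚ (λ v → c u v * rigEntry p u v w k * m w)) ⟩
  Σℚ (λ u → Σℚ (λ w → Σℚ (λ v → c u v * rigEntry p u v w k * m w)))
    ≡⟨ Σ-cong (λ u → Σ-swap (λ w v → c u v * rigEntry p u v w k * m w)) ⟩
  ΣΣ (λ u v → Σℚ (λ w → c u v * rigEntry p u v w k * m w))
    ≡⟨ ΣΣ-cong inner ⟩
  ΣΣ (λ u v → c u v * ((p u k - p v k) * (m u - m v))) ∎
  where
  open ≡-Reasoning
  inner : ∀ u v → Σℚ (λ w → c u v * rigEntry p u v w k * m w) ≡ c u v * ((p u k - p v k) * (m u - m v))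
  inner u v = begin
    Σℚ (λ w → c u v * rigEntry p u v w k * m w)
      ≡⟨ Σ-cong (λ w → trans (cong (λ r → c u v * r * m w) (rigEntry-δ p u v w k))
           (solve 5 (λ c d e x m → c :* ((d :- e) :* x) :* m := (c :* x) :* (m :* d) :+ (:- (c :* x)) :* (m :* e)) refl
             (c u v) (δ w u) (δ w v) (p u k - p v k) (m w))) ⟩
    Σℚ (λ w → c u v * (p u k - p v k) * (m w * δ w u) + - (c u v * (p u k - p v k)) * (m w * δ w v))
      ≡⟨ Σ-linear (c u v * (p u k - p v k)) (- (c u v * (p u k - p v k))) (λ w → m w * δ w u) (λ w → m w * δ w v) ⟩
    c u v * (p u k - p v k) * Σℚ (λ w → m w * δ w u) + - (c u v * (p u k - p v k)) * Σℚ (λ w → m w * δ w v)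
      ≡⟨ cong₂ (λ s t → c u v * (p u k - p v k) * s + - (c u v * (p u k - p v k)) * t) (Σ-δ m u) (Σ-δ m v) ⟩
    c u v * (p u k - p v k) * m u + - (c u v * (p u k - p v k)) * m v
      ≡⟨ solve 4 (λ c x s t → c :* x :* s :+ (:- (c :* x)) :* t := c :* (x :* (s :- t))) refl
           (c u v) (p u k - p v k) (m u) (m v) ⟩
    c u v * ((p u k - p v k) * (m u - m v)) ∎

-- General position

atPair : ∀ {m n} {X : Set} (f : Fin m → Fin n → X) u v →
  f (proj₁ (remQuot {m} n (combine u v))) (proj₂ (remQuot {m} n (combine u v))) ≡ f u v
atPair f u v = cong (λ r → f (proj₁ r) (proj₂ r)) (remQuot-combine u v)

module _ {n : ℕ} where

  -- The matrix lemmas have one index for rows and one for columns; here ordered pairs of vertices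
  -- and pairs of a vertex and a coordinate are packed into them.
  flat : (Fin n → Fin n → Fin n → Fin 3 → ℚ) → Fin (n *ℕ n) → Fin (n *ℕ 3) → ℚ
  flat R i x = R (quotient n i) (remainder {n} n i) (quotient 3 x) (remainder {n} 3 x)

  flatPairs : EdgeSet n → Fin (n *ℕ n) → Bool
  flatPairs E i = isPair E (quotient n i) (remainder {n} n i)

  free⇒flat : ∀ {p : Realization n} {E} → Free p E → RowsFree (flatPairs E) (flat (rigEntry p))
  free⇒flat {p} {E} free c off rel i = trans (cong c (sym (combine-remQuot {n} n i)))
    (free (λ u v → c (combine u v))
      (λ u v uv → off (combine u v) (trans (atPair (isPair E) u v) uv))
      (λ w k → trans
        (ΣΣ-cong (λ u v → cong (c (combine u v) *_) (sym
          (trans (atPair (λ u′ v′ → rigEntry p u′ v′ (quotient 3 (combine w k)) (remainder {n} 3 (combine w k))) u v)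
                 (atPair (rigEntry p u v) w k)))))
        (trans (sym (Σ-combine {n} {n} (λ i → c i * flat (rigEntry p) i (combine w k)))) (rel (combine w k))))
      (quotient n i) (remainder {n} n i))

  flat⇒free : ∀ {p : Realization n} {E} → RowsFree (flatPairs E) (flat (rigEntry p)) → Free p E
  flat⇒free {p} {E} free c on rel u v = trans (sym (atPair c u v))
    (free (λ i → c (quotient n i) (remainder {n} n i))
      (λ i → on (quotient n i) (remainder {n} n i))
      (λ x → trans (Σ-remQuot (λ u v → c u v * rigEntry p u v (quotient 3 x) (remainder {n} 3 x))) (rel (quotient 3 x) (remainder {n} 3 x)))
      (combine u v))

-- The rigidity matrix is linear in the realization, so moving by `t` times `s` adds `t` times the
-- matrix of `s`.
perturb : ∀ {n} {p : Realization n} {E} → Free p E → (s : Realization n) →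
  Σ ℚ λ t → t ≢ 0ℚ × Free (λ w k → p w k + t * s w k) E
perturb {n} {p} {E} free s = t , proj₁ (proj₂ rows) , flat⇒free {p = r} {E} (λ c off rel → proj₂ (proj₂ rows) c off
  (λ x → trans (Σ-cong (λ i → cong (c i *_) (sym (shift (quotient n i) (remainder {n} n i) (quotient 3 x) (remainder {n} 3 x))))) (rel x)))
  where
  rows = perturbRows (flatPairs E) (flat (rigEntry p)) (flat (rigEntry s)) (free⇒flat {p = p} {E} free)
  t = proj₁ rows
  r : Realization n
  r w k = p w k + t * s w k
  shift : ∀ u v w k → rigEntry r u v w k ≡ rigEntry p u v w k + t * rigEntry s u v w k
  shift u v w k = trans
    (rigEntry-combination p s r 1ℚ t k k k
      (λ u v → solve 5 (λ t a b c d → (a :+ t :* c) :- (b :+ t :* d) := con 1ℚ :* (a :- b) :+ t :* (c :- d)) refl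
        t (p u k) (p v k) (s u k) (s v k)) u v w)
    (cong (_+ t * rigEntry s u v w k) (*-identityˡ (rigEntry p u v w k)))

Moved : ∀ {n} → Realization n → EdgeSet n → Fin n → Fin 3 → ℚ → Set
Moved {n} p E w k β = Σ (Realization n) λ q →
  Free q E × q w k ≢ β × (∀ w′ k′ → w′ ≢ w ⊎ k′ ≢ k → q w′ k′ ≡ p w′ k′)

-- Only a coordinate equal to `β` is moved, in its own direction and by a nonzero amount, so it
-- leaves `β`. All other entries stay exactly as they were, which preserves whatever has been
-- arranged before.
moveOff : ∀ {n} {p : Realization n} {E} → Free p E → ∀ w k β → Moved p E w k β
moveOff {n} {p} {E} free w k β with p w k ≟ℚ β
... | no  ≢β = p , free , ≢β , λ _ _ _ → refl
... | yes ≡β = (λ w′ k′ → p w′ k′ + t * (δ w′ w * δ k′ k)) , proj₂ (proj₂ perturbed) , moved , fixed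
  where
  perturbed = perturb {p = p} {E} free (λ w′ k′ → δ w′ w * δ k′ k)
  t = proj₁ perturbed
  fixed : ∀ w′ k′ → w′ ≢ w ⊎ k′ ≢ k → p w′ k′ + t * (δ w′ w * δ k′ k) ≡ p w′ k′
  fixed w′ k′ (inj₁ w′≢w) = trans (cong (λ e → p w′ k′ + t * (e * δ k′ k)) (δ-≢ w′≢w))
    (solve 3 (λ a t e → a :+ t :* (con 0ℚ :* e) := a) refl (p w′ k′) t (δ k′ k))
  fixed w′ k′ (inj₂ k′≢k) = trans (cong (λ e → p w′ k′ + t * (δ w′ w * e)) (δ-≢ k′≢k))
    (solve 3 (λ a t e → a :+ t :* (e :* con 0ℚ) := a) refl (p w′ k′) t (δ w′ w))
  moved : p w k + t * (δ w w * δ k k) ≢ β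
  moved eq = proj₁ (proj₂ perturbed) (begin
    t                                           ≡⟨ solve 2 (λ t a → t := a :+ t :* (con 1ℚ :* con 1ℚ) :- a) refl t (p w k) ⟩
    p w k + t * (1ℚ * 1ℚ) - p w k               ≡⟨ cong₂ (λ d e → p w k + t * (d * e) - p w k) (δ-refl w) (δ-refl k) ⟨
    p w k + t * (δ w w * δ k k) - p w k         ≡⟨ cong₂ _-_ eq ≡β ⟩
    β - β                                       ≡⟨ +-inverseʳ β ⟩
    0ℚ                                          ∎)
    where open ≡-Reasoning

e₀ : Fin 3 → ℚ
e₀ zero    = 1ℚ
e₀ (suc _) = 0ℚ

Pinned : ∀ {n} → EdgeSet n → Fin n → Fin n → Realization n → Set
Pinned E x y p = Free p E × (∀ k → p x k ≡ 0ℚ) × (∀ k → p y k ≡ e₀ k)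

-- Once `x` and `y` differ in the first coordinate, a translation, a scaling and a shear normalise
-- them; being invertible, this map loses no information about loads.
pin : ∀ {n} {p : Realization n} {E} → Free p E → ∀ {x y} → x ≢ y → Σ (Realization n) (Pinned E x y)
pin {n} {p₀} {E} free₀ {x} {y} x≢y with moveOff {p = p₀} {E} free₀ x zero (p₀ y zero)
... | p , free , px≢ , fixed = q , free′ , qx , qy
  where
  a≢0 : p y zero - p x zero ≢ 0ℚ
  a≢0 a≡0 = px≢ (begin
    p x zero                          ≡⟨ solve 2 (λ x y → x := y :- (y :- x)) refl (p x zero) (p y zero) ⟩
    p y zero - (p y zero - p x zero)  ≡⟨ cong (λ a → p y zero - a) a≡0 ⟩
    p y zero - 0ℚ                     ≡⟨ +-identityʳ (p y zero) ⟩
    p y zero                          ≡⟨ fixed y zero (inj₁ (x≢y ∘ sym)) ⟩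
    p₀ y zero                         ∎)
    where open ≡-Reasoning
  a = p y zero - p x zero
  i = proj₁ (inverse a≢0)
  ia≡1 : i * a ≡ 1ℚ
  ia≡1 = proj₂ (inverse a≢0)
  -- Coordinate `k` combines the first displacement from `x` with the `k`-th. For `k` zero these
  -- coincide, so `β` is 0 there and `α` rescales by the inverse of `a`; for the others `α` is the
  -- shear that takes `y` to the axis.
  α β : Fin 3 → ℚ
  α zero    = i
  α (suc k) = - (i * (p y (suc k) - p x (suc k)))
  β zero    = 0ℚ
  β (suc k) = 1ℚ
  q : Realization n
  q w k = α k * (p w zero - p x zero) + β k * (p w k - p x k)
  qx : ∀ k → q x k ≡ 0ℚ
  qx k = solve 4 (λ α β a b → α :* (a :- a) :+ β :* (b :- b) := con 0ℚ) refl (α k) (β k) (p x zero) (p x k)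
  qy : ∀ k → q y k ≡ e₀ k
  qy zero    = trans (cong₂ _+_ ia≡1 (*-zeroˡ a)) (+-identityʳ 1ℚ)
  qy (suc k) = trans (solve 3 (λ i a d → (:- (i :* d)) :* a :+ con 1ℚ :* d := (con 1ℚ :- i :* a) :* d) refl i a (p y (suc k) - p x (suc k)))
    (trans (cong (λ e → (1ℚ - e) * (p y (suc k) - p x (suc k))) ia≡1) (*-zeroˡ (p y (suc k) - p x (suc k))))
  load-q : ∀ c w k → load q c w k ≡ α k * load p c w zero + β k * load p c w k
  load-q c w k = load-combination p q c (α k) (β k) k zero k
    (λ u v → solve 8 (λ α β a b c d x y → (α :* (a :- x) :+ β :* (b :- y)) :- (α :* (c :- x) :+ β :* (d :- y)) :=
                       α :* (a :- c) :+ β :* (b :- d)) refl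
      (α k) (β k) (p u zero) (p u k) (p v zero) (p v k) (p x zero) (p x k)) w
  -- The change of coordinates is triangular: the first coordinate of the load of `p` is recovered
  -- first, then substituted into the others.
  free′ : Free q E
  free′ c on eq = free c on (λ { w zero → load₀ w ; w (suc k) → loadₖ w k })
    where
    open ≡-Reasoning
    load₀ : ∀ w → load p c w zero ≡ 0ℚ
    load₀ w = begin
      load p c w zero            ≡⟨ *-identityˡ (load p c w zero) ⟨
      1ℚ * load p c w zero       ≡⟨ cong (_* load p c w zero) ia≡1 ⟨
      i * a * load p c w zero    ≡⟨ solve 3 (λ i a l → i :* a :* l := a :* (i :* l :+ con 0ℚ :* l)) refl i a (load p c w zero) ⟩
      a * (i * load p c w zero + 0ℚ * load p c w zero) ≡⟨ cong (a *_) (trans (sym (load-q c w zero)) (eq w zero)) ⟩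
      a * 0ℚ                     ≡⟨ *-zeroʳ a ⟩
      0ℚ                         ∎
    loadₖ : ∀ w k → load p c w (suc k) ≡ 0ℚ
    loadₖ w k = begin
      load p c w (suc k)
        ≡⟨ solve 2 (λ α l → l := α :* con 0ℚ :+ con 1ℚ :* l) refl (α (suc k)) (load p c w (suc k)) ⟩
      α (suc k) * 0ℚ + 1ℚ * load p c w (suc k)
        ≡⟨ cong (λ l → α (suc k) * l + 1ℚ * load p c w (suc k)) (load₀ w) ⟨
      α (suc k) * load p c w zero + 1ℚ * load p c w (suc k)
        ≡⟨ trans (sym (load-q c w (suc k))) (eq w (suc k)) ⟩
      0ℚ ∎

-- Edge sets

_true-false_ : ∀ {b} {A : Set} → b ≡ true → b ≡ false → A
refl true-false ()

∧-true⁻ : ∀ {a b} → a ∧ b ≡ true → a ≡ true × b ≡ true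
∧-true⁻ {true} eq = refl , eq

∧-true⁺ : ∀ {a b} → a ≡ true → b ≡ true → a ∧ b ≡ true
∧-true⁺ refl eq = eq

∨-true⁻ : ∀ {a b} → a ∨ b ≡ true → a ≡ true ⊎ b ≡ true
∨-true⁻ {true}  eq = inj₁ refl
∨-true⁻ {false} eq = inj₂ eq

∨-true⁺ˡ : ∀ {a b} → a ≡ true → a ∨ b ≡ true
∨-true⁺ˡ refl = refl

∨-true⁺ʳ : ∀ {a b} → b ≡ true → a ∨ b ≡ true
∨-true⁺ʳ {true}  eq = refl
∨-true⁺ʳ {false} eq = eq

⌊⌋-true⁻ : ∀ {A : Set} (a? : Dec A) → ⌊ a? ⌋ ≡ true → A
⌊⌋-true⁻ (yes a) _ = a

⌊⌋-true⁺ : ∀ {A : Set} (a? : Dec A) → A → ⌊ a? ⌋ ≡ true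
⌊⌋-true⁺ (yes _)  _ = refl
⌊⌋-true⁺ (no ¬a) a = contradiction a ¬a

false-if : ∀ {b} → b ≢ true → b ≡ false
false-if = ¬-not

module _ {n : ℕ} (E : EdgeSet n) {u v : Fin n} where

  isPair⁻ : isPair E u v ≡ true → E u v ≡ true × toℕ u < toℕ v
  isPair⁻ uv = proj₁ (∧-true⁻ uv) , ⌊⌋-true⁻ (toℕ u <? toℕ v) (proj₂ (∧-true⁻ {E u v} uv))

  isPair⁺ : E u v ≡ true → toℕ u < toℕ v → isPair E u v ≡ true
  isPair⁺ uv u<v = ∧-true⁺ uv (⌊⌋-true⁺ (toℕ u <? toℕ v) u<v)

Joins : ∀ {n} → Fin n → Fin n → Fin n → Fin n → Set
Joins x y u v = (u ≡ x × v ≡ y) ⊎ (u ≡ y × v ≡ x)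

-- An edge set is read only at increasing pairs, so an unordered pair has exactly one stored
-- position; `s` and `t` name it, and a stress on the edge is its value there.
record Oriented {n : ℕ} (x y s t : Fin n) : Set where
  field
    ordered : toℕ s < toℕ t
    joins   : Joins x y s t

  unique : ∀ {u v} → toℕ u < toℕ v → Joins x y u v → (u , v) ≡ (s , t)
  unique u<v j with j | joins
  ... | inj₁ (refl , refl) | inj₁ (refl , refl) = refl
  ... | inj₁ (refl , refl) | inj₂ (refl , refl) = contradiction u<v (<-asym ordered)
  ... | inj₂ (refl , refl) | inj₁ (refl , refl) = contradiction u<v (<-asym ordered)
  ... | inj₂ (refl , refl) | inj₂ (refl , refl) = refl

open Oriented

orient : ∀ {n} {x y : Fin n} → x ≢ y → Σ (Fin n) λ s → Σ (Fin n) λ t → Oriented x y s t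
orient {x = x} {y} x≢y with <-cmp x y
... | tri< x<y _ _ = x , y , record { ordered = x<y ; joins = inj₁ (refl , refl) }
... | tri≈ _ x≡y _ = contradiction x≡y x≢y
... | tri> _ _ y<x = y , x , record { ordered = y<x ; joins = inj₂ (refl , refl) }

endpoints : ∀ {n} {V : VSet n} {E} → IsGraph V E → ∀ {u v} → isPair E u v ≡ true → V u ≡ true × V v ≡ true
endpoints {E = E} G {u} {v} uv = IsGraph.closed G u v Euv , IsGraph.closed G v u (trans (IsGraph.sym G v u) Euv)
  where Euv = proj₁ (isPair⁻ E uv)

nonedge-joins : ∀ {n} {V : VSet n} {E x y} → IsGraph V E → E x y ≡ false → ∀ {u v} → Joins x y u v →
  isPair E u v ≡ false
nonedge-joins {E = E} G xy (inj₁ (refl , refl)) = false-if (λ uv → proj₁ (isPair⁻ E uv) true-false xy)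
nonedge-joins {E = E} {x} {y} G xy (inj₂ (refl , refl)) =
  false-if (λ uv → proj₁ (isPair⁻ E uv) true-false trans (IsGraph.sym G y x) xy)

pair-∪ : ∀ {n} (E₁ E₂ : EdgeSet n) {u v} → isPair (E₁ ∪E E₂) u v ≡ true →
  isPair E₁ u v ≡ true ⊎ isPair E₂ u v ≡ true
pair-∪ E₁ E₂ uv with isPair⁻ (E₁ ∪E E₂) uv
... | e , u<v with ∨-true⁻ e
...   | inj₁ e₁ = inj₁ (isPair⁺ E₁ e₁ u<v)
...   | inj₂ e₂ = inj₂ (isPair⁺ E₂ e₂ u<v)

⊆-∪ˡ : ∀ {n} (E₁ E₂ : EdgeSet n) → E₁ ⊆E (E₁ ∪E E₂)
⊆-∪ˡ E₁ E₂ u v uv = isPair⁺ (E₁ ∪E E₂) (∨-true⁺ˡ (proj₁ (isPair⁻ E₁ uv))) (proj₂ (isPair⁻ E₁ uv))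

⊆-∪ʳ : ∀ {n} (E₁ E₂ : EdgeSet n) → E₂ ⊆E (E₁ ∪E E₂)
⊆-∪ʳ E₁ E₂ u v uv = isPair⁺ (E₁ ∪E E₂) (∨-true⁺ʳ {E₁ u v} (proj₁ (isPair⁻ E₂ uv))) (proj₂ (isPair⁻ E₂ uv))

⊆-addEdge : ∀ {n} (E : EdgeSet n) x y → E ⊆E addEdge E x y
⊆-addEdge E x y u v uv = isPair⁺ (addEdge E x y) (∨-true⁺ˡ (proj₁ (isPair⁻ E uv))) (proj₂ (isPair⁻ E uv))

addEdge-mono : ∀ {n} {E F : EdgeSet n} x y → E ⊆E F → addEdge E x y ⊆E addEdge F x y
addEdge-mono {E = E} {F} x y E⊆F u v uv with isPair⁻ (addEdge E x y) uv
... | e , u<v with ∨-true⁻ {E u v} e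
...   | inj₁ Euv = ⊆-addEdge F x y u v (E⊆F u v (isPair⁺ E Euv u<v))
...   | inj₂ new = isPair⁺ (addEdge F x y) (∨-true⁺ʳ {F u v} new) u<v

module _ {n : ℕ} {E : EdgeSet n} {x y s t : Fin n} (o : Oriented x y s t) where

  pair-addEdge : ∀ {u v} → isPair (addEdge E x y) u v ≡ true → isPair E u v ≡ true ⊎ (u , v) ≡ (s , t)
  pair-addEdge {u} {v} uv with isPair⁻ (addEdge E x y) uv
  ... | e , u<v with ∨-true⁻ {E u v} e
  ...   | inj₁ Euv = inj₁ (isPair⁺ E Euv u<v)
  ...   | inj₂ new with ∨-true⁻ {⌊ u ≟ x ⌋ ∧ ⌊ v ≟ y ⌋} new
  ...     | inj₁ xy = inj₂ (unique o u<v (inj₁ (⌊⌋-true⁻ (u ≟ x) (proj₁ (∧-true⁻ xy)) , ⌊⌋-true⁻ (v ≟ y) (proj₂ (∧-true⁻ {⌊ u ≟ x ⌋} xy)))))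
  ...     | inj₂ yx = inj₂ (unique o u<v (inj₂ (⌊⌋-true⁻ (u ≟ y) (proj₁ (∧-true⁻ yx)) , ⌊⌋-true⁻ (v ≟ x) (proj₂ (∧-true⁻ {⌊ u ≟ y ⌋} yx)))))

  new-pair : isPair (addEdge E x y) s t ≡ true
  new-pair = isPair⁺ (addEdge E x y) (∨-true⁺ʳ {E s t} (st (joins o))) (ordered o)
    where
    st : Joins x y s t → ((⌊ s ≟ x ⌋ ∧ ⌊ t ≟ y ⌋) ∨ (⌊ s ≟ y ⌋ ∧ ⌊ t ≟ x ⌋)) ≡ true
    st (inj₁ (s≡x , t≡y)) = ∨-true⁺ˡ (∧-true⁺ (⌊⌋-true⁺ (s ≟ x) s≡x) (⌊⌋-true⁺ (t ≟ y) t≡y))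
    st (inj₂ (s≡y , t≡x)) = ∨-true⁺ʳ {⌊ s ≟ x ⌋ ∧ ⌊ t ≟ y ⌋} (∧-true⁺ (⌊⌋-true⁺ (s ≟ y) s≡y) (⌊⌋-true⁺ (t ≟ x) t≡x))

  pair-addEdge-false : ∀ {u v} → isPair E u v ≡ false → (u , v) ≢ (s , t) → isPair (addEdge E x y) u v ≡ false
  pair-addEdge-false uv ≢st = false-if (λ uv⁺ → [ (λ old → old true-false uv) , ≢st ]′ (pair-addEdge uv⁺))

hasPair-addEdge : ∀ {n} (E : EdgeSet n) {x y} → x ≢ y → hasPair (addEdge E x y) x y
hasPair-addEdge E {x} {y} x≢y with orient x≢y
... | s , t , o with joins o | new-pair {E = E} o
...   | inj₁ (refl , refl) | new = ∨-true⁺ˡ new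
...   | inj₂ (refl , refl) | new = ∨-true⁺ʳ {isPair (addEdge E x y) x y} new

-- Union along an implied nonedge

_≟²_ : ∀ {n} (p q : Fin n × Fin n) → Dec (p ≡ q)
_≟²_ = ≡-dec _≟_ _≟_

-- With one row left, the load at `s` is its coefficient times a nonzero coordinate difference.
single-free : ∀ {n} (p : Realization n) (c : Stress n) {s t} k → s ≢ t → p s k ≢ p t k →
  (∀ u v → (u , v) ≢ (s , t) → c u v ≡ 0ℚ) → load p c s k ≡ 0ℚ → c s t ≡ 0ℚ
single-free p c {s} {t} k s≢t ps≢pt off eq = no-zero-divisors {p s k - p t k} (begin
  (p s k - p t k) * c s t
    ≡⟨ solve 2 (λ d c → d :* c := c :* ((con 1ℚ :- con 0ℚ) :* d)) refl (p s k - p t k) (c s t) ⟩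
  c s t * ((1ℚ - 0ℚ) * (p s k - p t k))
    ≡⟨ cong₂ (λ a b → c s t * ((a - b) * (p s k - p t k))) (δ-refl s) (δ-≢ s≢t) ⟨
  c s t * ((δ s s - δ s t) * (p s k - p t k))
    ≡⟨ cong (c s t *_) (rigEntry-δ p s t s k) ⟨
  c s t * rigEntry p s t s k
    ≡⟨ ΣΣ-single (λ u v → c u v * rigEntry p u v s k) s t
         (λ u v ≢st → trans (cong (_* rigEntry p u v s k) (off u v ≢st)) (*-zeroˡ (rigEntry p u v s k))) ⟨
  load p c s k
    ≡⟨ eq ⟩
  0ℚ ∎)
  (λ d≡0 → ps≢pt (trans (solve 2 (λ a b → a := (a :- b) :+ b) refl (p s k) (p t k))
                        (trans (cong (_+ p t k) d≡0) (+-identityˡ (p t k)))))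
  where open ≡-Reasoning

oriented-≢ : ∀ {n} {x y s t : Fin n} → Oriented x y s t → ∀ {p : Fin n → ℚ} → p x ≢ p y → p s ≢ p t
oriented-≢ o with joins o
... | inj₁ (refl , refl) = λ ≢ → ≢
... | inj₂ (refl , refl) = λ ≢ → ≢ ∘ sym

oriented-distinct : ∀ {n} {x y s t : Fin n} → Oriented x y s t → s ≢ t
oriented-distinct o refl = <-irrefl refl (ordered o)

-- Two stresses through f are combined so that f cancels.
module Elimination {n : ℕ} {E₁ E₂ C₁ C₂ : EdgeSet n} {x y s t : Fin n} (o : Oriented x y s t)
  (disjoint : EdgeDisjoint E₁ E₂) (C₁⊆ : C₁ ⊆E addEdge E₁ x y) (C₂⊆ : C₂ ⊆E addEdge E₂ x y)
  {p : Realization n} (k : Fin 3) (px≢py : p x k ≢ p y k) (free : Free p (E₁ ∪E E₂)) where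

  off₁ : ∀ {c} → On C₁ c → ∀ {u v} → isPair E₁ u v ≡ false → (u , v) ≢ (s , t) → c u v ≡ 0ℚ
  off₁ on {u} {v} uv ≢st = on u v (false-if (λ C → C₁⊆ u v C true-false pair-addEdge-false {E = E₁} o uv ≢st))

  off₂ : ∀ {c} → On C₂ c → ∀ {u v} → isPair E₂ u v ≡ false → (u , v) ≢ (s , t) → c u v ≡ 0ℚ
  off₂ on {u} {v} uv ≢st = on u v (false-if (λ C → C₂⊆ u v C true-false pair-addEdge-false {E = E₂} o uv ≢st))

  side₁ : ∀ {u v} → isPair (E₁ ∪E E₂) u v ≡ false → isPair E₁ u v ≡ false
  side₁ uv = false-if (λ e → ⊆-∪ˡ E₁ E₂ _ _ e true-false uv)

  side₂ : ∀ {u v} → isPair (E₁ ∪E E₂) u v ≡ false → isPair E₂ u v ≡ false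
  side₂ uv = false-if (λ e → ⊆-∪ʳ E₁ E₂ _ _ e true-false uv)

  -- The combination `d` cancels at `f`, so it is a stress on the union and vanishes. On edges of
  -- `E₂` disjointness kills `c₁`, so there `c₂` vanishes too; what is left of it is a single row.
  free₂ : ∀ c₁ → On C₁ c₁ → (∀ w k → load p c₁ w k ≡ 0ℚ) → c₁ s t ≢ 0ℚ → Free p C₂
  free₂ c₁ on₁ eq₁ c₁≢0 c₂ on₂ eq₂ = vanish
    where
    open ≡-Reasoning
    d : Stress n
    d u v = c₂ s t * c₁ u v + - c₁ s t * c₂ u v
    d-on : On (E₁ ∪E E₂) d
    d-on u v uv with (u , v) ≟² (s , t)
    ... | yes refl = solve 2 (λ a b → a :* b :+ (:- b) :* a := con 0ℚ) refl (c₂ s t) (c₁ s t)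
    ... | no  ≢st  = trans (cong₂ (λ a b → c₂ s t * a + - c₁ s t * b) (off₁ on₁ (side₁ uv) ≢st) (off₂ on₂ (side₂ uv) ≢st))
                           (solve 2 (λ a b → a :* con 0ℚ :+ (:- b) :* con 0ℚ := con 0ℚ) refl (c₂ s t) (c₁ s t))
    d≡0 : ∀ u v → d u v ≡ 0ℚ
    d≡0 = free d d-on (λ w k → trans (load-linear p (c₂ s t) (- c₁ s t) c₁ c₂ w k)
      (trans (cong₂ (λ a b → c₂ s t * a + - c₁ s t * b) (eq₁ w k) (eq₂ w k))
             (solve 2 (λ a b → a :* con 0ℚ :+ (:- b) :* con 0ℚ := con 0ℚ) refl (c₂ s t) (c₁ s t))))
    away : ∀ u v → (u , v) ≢ (s , t) → c₂ u v ≡ 0ℚ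
    away u v ≢st with isPair E₂ u v in uv
    ... | false = off₂ on₂ uv ≢st
    ... | true  = no-zero-divisors (begin
      c₁ s t * c₂ u v                        ≡⟨ solve 3 (λ a b e → a :* b := :- (e :* con 0ℚ :+ (:- a) :* b)) refl (c₁ s t) (c₂ u v) (c₂ s t) ⟩
      - (c₂ s t * 0ℚ + - c₁ s t * c₂ u v)    ≡⟨ cong (λ a → - (c₂ s t * a + - c₁ s t * c₂ u v)) (off₁ on₁ uv₁ ≢st) ⟨
      - d u v                                ≡⟨ cong (-_) (d≡0 u v) ⟩
      0ℚ                                     ∎) c₁≢0
      where uv₁ = false-if (λ e → uv true-false disjoint u v e)
    vanish : ∀ u v → c₂ u v ≡ 0ℚ
    vanish u v with (u , v) ≟² (s , t)
    ... | no  ≢st  = away u v ≢st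
    ... | yes refl = single-free p c₂ k (oriented-distinct o) (oriented-≢ o {λ w → p w k} px≢py) away (eq₂ s k)

  -- A stress of `C₁` that vanishes at `f` already lives on the union; one that does not would make
  -- `C₂` free.
  free₁ : ¬ Free p C₂ → Free p C₁
  free₁ ¬free₂ c on eq with c s t ≟ℚ 0ℚ
  ... | no  ≢0 = ⊥-elim (¬free₂ (free₂ c on eq ≢0))
  ... | yes ≡0 = free c c-on eq
    where
    c-on : On (E₁ ∪E E₂) c
    c-on u v uv with (u , v) ≟² (s , t)
    ... | yes refl = ≡0
    ... | no  ≢st  = off₁ on (side₁ uv) ≢st

dependent-∪ : ∀ {n} {E₁ E₂ C₁ C₂ : EdgeSet n} {x y} → x ≢ y → EdgeDisjoint E₁ E₂ →
  C₁ ⊆E addEdge E₁ x y → C₂ ⊆E addEdge E₂ x y → Dependent C₁ → Dependent C₂ → Dependent (E₁ ∪E E₂)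
dependent-∪ {E₁ = E₁} {E₂} {C₁} {C₂} {x} {y} x≢y disjoint C₁⊆ C₂⊆ dep₁ dep₂ (p₀ , rows)
  with orient x≢y | moveOff {p = p₀} {E₁ ∪E E₂} (rows⇒free {p = p₀} {E₁ ∪E E₂} rows) x zero (p₀ y zero)
... | s , t , o | p , free , px≢ , fixed = dep₁ (p , free⇒rows {p = p} {C₁} (free₁ (λ f → dep₂ (p , free⇒rows {p = p} {C₂} f))))
  where
  open Elimination {E₁ = E₁} {E₂} {C₁} {C₂} o disjoint C₁⊆ C₂⊆ {p} zero
    -- Were `x` and `y` to coincide, the row of `f` would be zero and a stress on `f` alone could
    -- survive; hence the move of `x`.
    (λ eq → px≢ (trans eq (fixed y zero (inj₁ (x≢y ∘ sym))))) free

-- Gluing along a hinge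

-- `⊆E` constrains only increasing pairs, so a subset of the edges of a graph need not be an
-- `IsGraph`; this is the part of that structure which it inherits.
Ends : ∀ {n} → VSet n → EdgeSet n → Set
Ends V E = ∀ u v → isPair E u v ≡ true → V u ≡ true × V v ≡ true

module _ {n : ℕ} {V : VSet n} {E : EdgeSet n} (ends : Ends V E) {c : Stress n} (on : On E c) where

  load-cong : ∀ {p q : Realization n} → (∀ w → V w ≡ true → ∀ k → p w k ≡ q w k) →
    ∀ w k → load p c w k ≡ load q c w k
  load-cong {p} {q} p≡q w k = ΣΣ-cong term
    where
    term : ∀ u v → c u v * rigEntry p u v w k ≡ c u v * rigEntry q u v w k
    term u v with isPair E u v in uv
    ... | false rewrite on u v uv = trans (*-zeroˡ (rigEntry p u v w k)) (sym (*-zeroˡ (rigEntry q u v w k)))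
    ... | true  = cong (c u v *_) (begin
      rigEntry p u v w k                   ≡⟨ rigEntry-δ p u v w k ⟩
      (δ w u - δ w v) * (p u k - p v k)    ≡⟨ cong₂ (λ a b → (δ w u - δ w v) * (a - b)) (p≡q u (proj₁ (ends u v uv)) k) (p≡q v (proj₂ (ends u v uv)) k) ⟩
      (δ w u - δ w v) * (q u k - q v k)    ≡⟨ rigEntry-δ q u v w k ⟨
      rigEntry q u v w k                   ∎)
      where open ≡-Reasoning

  load-outside : ∀ (p : Realization n) {w} → V w ≡ false → ∀ k → load p c w k ≡ 0ℚ
  load-outside p {w} w∉V k = ΣΣ-zero term
    where
    term : ∀ u v → c u v * rigEntry p u v w k ≡ 0ℚ
    term u v with isPair E u v in uv
    ... | false rewrite on u v uv = *-zeroˡ (rigEntry p u v w k)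
    ... | true  = begin
      c u v * rigEntry p u v w k                     ≡⟨ cong (c u v *_) (rigEntry-δ p u v w k) ⟩
      c u v * ((δ w u - δ w v) * (p u k - p v k))    ≡⟨ cong₂ (λ a b → c u v * ((a - b) * (p u k - p v k))) (δ-≢ (outside (proj₁ (ends u v uv)))) (δ-≢ (outside (proj₂ (ends u v uv)))) ⟩
      c u v * ((0ℚ - 0ℚ) * (p u k - p v k))          ≡⟨ solve 2 (λ c d → c :* ((con 0ℚ :- con 0ℚ) :* d) := con 0ℚ) refl (c u v) (p u k - p v k) ⟩
      0ℚ                                             ∎
      where
      open ≡-Reasoning
      outside : ∀ {z} → V z ≡ true → w ≢ z
      outside z∈V refl = z∈V true-false w∉V

-- A translation does no work: it gives both ends of every edge the same velocity.
force-balance : ∀ {n} (p : Realization n) c k → Σℚ (λ w → load p c w k) ≡ 0ℚ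
force-balance p c k = begin
  Σℚ (λ w → load p c w k)
    ≡⟨ Σ-cong (λ w → *-identityʳ (load p c w k)) ⟨
  Σℚ (λ w → load p c w k * 1ℚ)
    ≡⟨ work p c k (λ _ → 1ℚ) ⟩
  ΣΣ (λ u v → c u v * ((p u k - p v k) * (1ℚ - 1ℚ)))
    ≡⟨ ΣΣ-zero (λ u v → solve 2 (λ c d → c :* (d :* (con 1ℚ :- con 1ℚ)) := con 0ℚ) refl (c u v) (p u k - p v k)) ⟩
  0ℚ ∎
  where open ≡-Reasoning

-- Along each edge the work is symmetric in the two coordinates; the difference of the two sides is
-- the work against a rotation in the plane of `i` and `j`.
torque-balance : ∀ {n} (p : Realization n) c i j →
  Σℚ (λ w → load p c w i * p w j) ≡ Σℚ (λ w → load p c w j * p w i)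
torque-balance p c i j = begin
  Σℚ (λ w → load p c w i * p w j)
    ≡⟨ work p c i (λ w → p w j) ⟩
  ΣΣ (λ u v → c u v * ((p u i - p v i) * (p u j - p v j)))
    ≡⟨ ΣΣ-cong (λ u v → cong (c u v *_) (*-comm (p u i - p v i) (p u j - p v j))) ⟩
  ΣΣ (λ u v → c u v * ((p u j - p v j) * (p u i - p v i)))
    ≡⟨ work p c j (λ w → p w i) ⟨
  Σℚ (λ w → load p c w j * p w i) ∎
  where open ≡-Reasoning

Σ-pair : ∀ {m} (f : Fin m → ℚ) {x y} → x ≢ y → (∀ i → i ≢ x → i ≢ y → f i ≡ 0ℚ) → Σℚ f ≡ f x + f y
Σ-pair f {x} {y} x≢y off = begin
  Σℚ f                                              ≡⟨ Σ-cong term ⟩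
  Σℚ (λ i → f i * δ i x + f i * δ i y)              ≡⟨ Σ-+ (λ i → f i * δ i x) (λ i → f i * δ i y) ⟩
  Σℚ (λ i → f i * δ i x) + Σℚ (λ i → f i * δ i y)   ≡⟨ cong₂ _+_ (Σ-δ f x) (Σ-δ f y) ⟩
  f x + f y                                         ∎
  where
  open ≡-Reasoning
  term : ∀ i → f i ≡ f i * δ i x + f i * δ i y
  term i with i ≟ x | i ≟ y
  ... | yes refl | yes refl = contradiction refl x≢y
  ... | yes _    | no  _    = solve 1 (λ a → a := a :* con 1ℚ :+ a :* con 0ℚ) refl (f i)
  ... | no  _    | yes _    = solve 1 (λ a → a := a :* con 0ℚ :+ a :* con 1ℚ) refl (f i)
  ... | no  i≢x  | no  i≢y  rewrite off i i≢x i≢y = refl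

unit : ∀ {n} → Fin n → Fin n → Stress n
unit s t u v = δ u s * δ v t

unit-off : ∀ {n} {s t u v : Fin n} → (u , v) ≢ (s , t) → unit s t u v ≡ 0ℚ
unit-off {s = s} {t} {u} {v} ≢st with u ≟ s | v ≟ t
... | yes refl | yes refl = contradiction refl ≢st
... | yes _    | no  _    = refl
... | no  _    | yes _    = refl
... | no  _    | no  _    = refl

-- Exchanging the ends changes the sign of both factors, so the load can be written in `x` and `y`
-- whichever of them is stored first.
load-unit : ∀ {n} (p : Realization n) {x y s t} → Oriented x y s t → ∀ w k →
  load p (unit s t) w k ≡ (δ w x - δ w y) * (p x k - p y k)
load-unit p {x} {y} {s} {t} o w k = begin
  load p (unit s t) w k
    ≡⟨ ΣΣ-single (λ u v → unit s t u v * rigEntry p u v w k) s t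
         (λ u v ≢st → trans (cong (_* rigEntry p u v w k) (unit-off ≢st)) (*-zeroˡ (rigEntry p u v w k))) ⟩
  δ s s * δ t t * rigEntry p s t w k
    ≡⟨ cong₂ (λ a b → a * b * rigEntry p s t w k) (δ-refl s) (δ-refl t) ⟩
  1ℚ * 1ℚ * rigEntry p s t w k
    ≡⟨ cong (1ℚ * 1ℚ *_) (rigEntry-δ p s t w k) ⟩
  1ℚ * 1ℚ * ((δ w s - δ w t) * (p s k - p t k))
    ≡⟨ either (joins o) ⟩
  (δ w x - δ w y) * (p x k - p y k) ∎
  where
  open ≡-Reasoning
  either : Joins x y s t → 1ℚ * 1ℚ * ((δ w s - δ w t) * (p s k - p t k)) ≡ (δ w x - δ w y) * (p x k - p y k)
  either (inj₁ (refl , refl)) = solve 4 (λ d e a b → con 1ℚ :* con 1ℚ :* ((d :- e) :* (a :- b)) := (d :- e) :* (a :- b)) refl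
    (δ w s) (δ w t) (p s k) (p t k)
  either (inj₂ (refl , refl)) = solve 4 (λ d e a b → con 1ℚ :* con 1ℚ :* ((d :- e) :* (a :- b)) := (e :- d) :* (b :- a)) refl
    (δ w s) (δ w t) (p s k) (p t k)

-- A load supported on x and y that satisfies force and torque balance acts
-- along the line xy, so it is resolved by the edge f.
resolve : ∀ {n} {x y s t : Fin n} → x ≢ y → Oriented x y s t → (p : Realization n) (c : Stress n) →
  (∀ k → p x k ≡ 0ℚ) → (∀ k → p y k ≡ e₀ k) →
  (∀ w → w ≢ x → w ≢ y → ∀ k → load p c w k ≡ 0ℚ) →
  ∀ w k → load p (λ u v → 1ℚ * c u v + - load p c y zero * unit s t u v) w k ≡ 0ℚ
resolve {x = x} {y} {s} {t} x≢y o p c px py off w k = begin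
  load p (λ u v → 1ℚ * c u v + - load p c y zero * unit s t u v) w k
    ≡⟨ load-linear p 1ℚ (- load p c y zero) c (unit s t) w k ⟩
  1ℚ * load p c w k + - load p c y zero * load p (unit s t) w k
    ≡⟨ cong (λ l → 1ℚ * load p c w k + - load p c y zero * l)
         (trans (load-unit p o w k) (cong₂ (λ a b → (δ w x - δ w y) * (a - b)) (px k) (py k))) ⟩
  1ℚ * load p c w k + - load p c y zero * ((δ w x - δ w y) * (0ℚ - e₀ k))
    ≡⟨ balance (w ≟ x) (w ≟ y) ⟩
  0ℚ ∎
  where
  open ≡-Reasoning
  ly = load p c y zero
  opposite : ∀ k → load p c x k ≡ - load p c y k
  opposite k = begin
    load p c x k
      ≡⟨ solve 2 (λ a b → a := (a :+ b) :- b) refl (load p c x k) (load p c y k) ⟩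
    load p c x k + load p c y k - load p c y k
      ≡⟨ cong (_- load p c y k) (trans (sym (Σ-pair (λ w → load p c w k) x≢y (λ w w≢x w≢y → off w w≢x w≢y k))) (force-balance p c k)) ⟩
    0ℚ - load p c y k
      ≡⟨ +-identityˡ (- load p c y k) ⟩
    - load p c y k ∎
  moment : ∀ i j → Σℚ (λ w → load p c w i * p w j) ≡ load p c y i * e₀ j
  moment i j = trans (Σ-single (λ w → load p c w i * p w j) y at) (cong (load p c y i *_) (py j))
    where
    at : ∀ w → w ≢ y → load p c w i * p w j ≡ 0ℚ
    at w w≢y with w ≟ x
    ... | yes refl = trans (cong (load p c w i *_) (px j)) (*-zeroʳ (load p c w i))
    ... | no  w≢x  = trans (cong (_* p w j) (off w w≢x w≢y i)) (*-zeroˡ (p w j))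
  -- With `x` at the origin only `y` has a moment. Its transversal load has lever arm 1 and its
  -- axial load lever arm 0, so torque balance removes the former.
  along : ∀ k → load p c y k ≡ ly * e₀ k
  along zero    = sym (*-identityʳ ly)
  along (suc k) = begin
    load p c y (suc k)         ≡⟨ *-identityʳ (load p c y (suc k)) ⟨
    load p c y (suc k) * 1ℚ    ≡⟨ moment (suc k) zero ⟨
    Σℚ (λ w → load p c w (suc k) * p w zero) ≡⟨ torque-balance p c (suc k) zero ⟩
    Σℚ (λ w → load p c w zero * p w (suc k)) ≡⟨ moment zero (suc k) ⟩
    ly * 0ℚ                    ∎
  balance : Dec (w ≡ x) → Dec (w ≡ y) → 1ℚ * load p c w k + - ly * ((δ w x - δ w y) * (0ℚ - e₀ k)) ≡ 0ℚ
  balance (yes refl) _ = begin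
    1ℚ * load p c x k + - ly * ((δ x x - δ x y) * (0ℚ - e₀ k))
      ≡⟨ cong₂ (λ l d → 1ℚ * l + - ly * (d * (0ℚ - e₀ k))) (trans (opposite k) (cong (-_) (along k))) (cong₂ _-_ (δ-refl x) (δ-≢ x≢y)) ⟩
    1ℚ * - (ly * e₀ k) + - ly * ((1ℚ - 0ℚ) * (0ℚ - e₀ k))
      ≡⟨ solve 2 (λ l e → con 1ℚ :* (:- (l :* e)) :+ (:- l) :* ((con 1ℚ :- con 0ℚ) :* (con 0ℚ :- e)) := con 0ℚ) refl ly (e₀ k) ⟩
    0ℚ ∎
  balance (no _) (yes refl) = begin
    1ℚ * load p c y k + - ly * ((δ y x - δ y y) * (0ℚ - e₀ k))
      ≡⟨ cong₂ (λ l d → 1ℚ * l + - ly * (d * (0ℚ - e₀ k))) (along k) (cong₂ _-_ (δ-≢ (x≢y ∘ sym)) (δ-refl y)) ⟩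
    1ℚ * (ly * e₀ k) + - ly * ((0ℚ - 1ℚ) * (0ℚ - e₀ k))
      ≡⟨ solve 2 (λ l e → con 1ℚ :* (l :* e) :+ (:- l) :* ((con 0ℚ :- con 1ℚ) :* (con 0ℚ :- e)) := con 0ℚ) refl ly (e₀ k) ⟩
    0ℚ ∎
  balance (no w≢x) (no w≢y) = begin
    1ℚ * load p c w k + - ly * ((δ w x - δ w y) * (0ℚ - e₀ k))
      ≡⟨ cong₂ (λ l d → 1ℚ * l + - ly * (d * (0ℚ - e₀ k))) (off w w≢x w≢y k) (cong₂ _-_ (δ-≢ w≢x) (δ-≢ w≢y)) ⟩
    1ℚ * 0ℚ + - ly * ((0ℚ - 0ℚ) * (0ℚ - e₀ k))
      ≡⟨ solve 2 (λ l e → con 1ℚ :* con 0ℚ :+ (:- l) :* ((con 0ℚ :- con 0ℚ) :* (con 0ℚ :- e)) := con 0ℚ) refl ly (e₀ k) ⟩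
    0ℚ ∎

-- Only one side has to remain independent together with `f`. Its share of a stress of `F` loads
-- just the hinge, and `f` resolves that load; so this share vanishes, and the other share is then a
-- stress of `F₂` without load.
module Glue {n : ℕ} {V₁ V₂ : VSet n} {F F₁ F₂ : EdgeSet n} {x y s t : Fin n}
  (x≢y : x ≢ y) (o : Oriented x y s t) (inter : InterIs V₁ V₂ x y)
  (ends₁ : Ends V₁ F₁) (ends₂ : Ends V₂ F₂)
  (cover : ∀ u v → isPair F u v ≡ true → isPair F₁ u v ≡ true ⊎ isPair F₂ u v ≡ true)
  (st∉F₁ : isPair F₁ s t ≡ false)
  {p₁ p₂ : Realization n} (free₁ : Free p₁ (addEdge F₁ x y)) (free₂ : Free p₂ F₂)
  (p₁x : ∀ k → p₁ x k ≡ 0ℚ) (p₁y : ∀ k → p₁ y k ≡ e₀ k)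
  (p₂x : ∀ k → p₂ x k ≡ 0ℚ) (p₂y : ∀ k → p₂ y k ≡ e₀ k) where

  glued : Realization n
  glued w k = if V₁ w then p₁ w k else p₂ w k

  glued₁ : ∀ w → V₁ w ≡ true → ∀ k → glued w k ≡ p₁ w k
  glued₁ w w∈V₁ k rewrite w∈V₁ = refl

  glued₂ : ∀ w → V₂ w ≡ true → ∀ k → glued w k ≡ p₂ w k
  glued₂ w w∈V₂ k with V₁ w in w∈V₁
  ... | false = refl
  ... | true with proj₁ (inter w) (∧-true⁺ w∈V₁ w∈V₂)
  ...   | inj₁ refl = trans (p₁x k) (sym (p₂x k))
  ...   | inj₂ refl = trans (p₁y k) (sym (p₂y k))

  module _ (c : Stress n) (on : On F c) (eq : ∀ w k → load glued c w k ≡ 0ℚ) where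

    open ≡-Reasoning

    -- `c₂` is the remainder, so the two shares add up to `c` even at a pair common to `F₁` and
    -- `F₂`. The coefficient in `d` is the axial load at `y`, because the unit stress on `f` has
    -- load 1 there.
    c₁ c₂ d : Stress n
    c₁ u v = mask (isPair F₁ u v) (c u v)
    c₂ u v = 1ℚ * c u v + - 1ℚ * c₁ u v
    d  u v = 1ℚ * c₁ u v + - load p₁ c₁ y zero * unit s t u v

    on₁ : On F₁ c₁
    on₁ u v = mask-false (c u v)

    on₂ : On F₂ c₂
    on₂ u v uv with isPair F₁ u v in uv₁
    ... | true  = solve 1 (λ a → con 1ℚ :* a :+ con (- 1ℚ) :* a := con 0ℚ) refl (c u v)
    ... | false rewrite on u v (false-if (λ F → [ (λ e → e true-false uv₁) , (λ e → e true-false uv) ]′ (cover u v F))) = refl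

    split : ∀ w k → load p₁ c₁ w k + load p₂ c₂ w k ≡ 0ℚ
    split w k = begin
      load p₁ c₁ w k + load p₂ c₂ w k
        ≡⟨ cong₂ _+_ (load-cong ends₁ on₁ {glued} {p₁} glued₁ w k) (load-cong ends₂ on₂ {glued} {p₂} glued₂ w k) ⟨
      load glued c₁ w k + load glued c₂ w k
        ≡⟨ cong (load glued c₁ w k +_) (load-linear glued 1ℚ (- 1ℚ) c c₁ w k) ⟩
      load glued c₁ w k + (1ℚ * load glued c w k + - 1ℚ * load glued c₁ w k)
        ≡⟨ cong (λ l → load glued c₁ w k + (1ℚ * l + - 1ℚ * load glued c₁ w k)) (eq w k) ⟩
      load glued c₁ w k + (1ℚ * 0ℚ + - 1ℚ * load glued c₁ w k)
        ≡⟨ solve 1 (λ a → a :+ (con 1ℚ :* con 0ℚ :+ con (- 1ℚ) :* a) := con 0ℚ) refl (load glued c₁ w k) ⟩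
      0ℚ ∎

    -- A vertex off the hinge lies on at most one side; the other share has no load there, and the
    -- two loads cancel.
    hinge-load : ∀ w → w ≢ x → w ≢ y → ∀ k → load p₁ c₁ w k ≡ 0ℚ
    hinge-load w w≢x w≢y k with V₁ w in w∈V₁
    ... | false = load-outside ends₁ on₁ p₁ w∈V₁ k
    ... | true  = trans (sym (+-identityʳ (load p₁ c₁ w k)))
      (trans (cong (load p₁ c₁ w k +_) (sym (load-outside ends₂ on₂ p₂ w∉V₂ k))) (split w k))
      where
      w∉V₂ : V₂ w ≡ false
      w∉V₂ = false-if (λ w∈V₂ → [ w≢x , w≢y ]′ (proj₁ (inter w) (∧-true⁺ w∈V₁ w∈V₂)))

    d≡0 : ∀ u v → d u v ≡ 0ℚ
    d≡0 = free₁ d d-on (resolve x≢y o p₁ c₁ p₁x p₁y hinge-load)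
      where
      d-on : On (addEdge F₁ x y) d
      d-on u v uv with (u , v) ≟² (s , t)
      ... | yes refl = new-pair {E = F₁} o true-false uv
      ... | no  ≢st  = trans
        (cong₂ (λ a b → 1ℚ * a + - load p₁ c₁ y zero * b)
          (on₁ u v (false-if (λ e → ⊆-addEdge F₁ x y u v e true-false uv))) (unit-off ≢st))
        (solve 1 (λ l → con 1ℚ :* con 0ℚ :+ (:- l) :* con 0ℚ := con 0ℚ) refl (load p₁ c₁ y zero))

    c₁≡0 : ∀ u v → c₁ u v ≡ 0ℚ
    c₁≡0 u v with (u , v) ≟² (s , t)
    ... | yes refl = on₁ u v st∉F₁
    ... | no  ≢st  = begin
      c₁ u v                                       ≡⟨ solve 2 (λ a l → a := con 1ℚ :* a :+ (:- l) :* con 0ℚ) refl (c₁ u v) (load p₁ c₁ y zero) ⟩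
      1ℚ * c₁ u v + - load p₁ c₁ y zero * 0ℚ       ≡⟨ cong (λ e → 1ℚ * c₁ u v + - load p₁ c₁ y zero * e) (unit-off ≢st) ⟨
      d u v                                        ≡⟨ d≡0 u v ⟩
      0ℚ                                           ∎

    c₂≡0 : ∀ u v → c₂ u v ≡ 0ℚ
    c₂≡0 = free₂ c₂ on₂ (λ w k → begin
      load p₂ c₂ w k                     ≡⟨ +-identityˡ (load p₂ c₂ w k) ⟨
      0ℚ + load p₂ c₂ w k                ≡⟨ cong (_+ load p₂ c₂ w k) (ΣΣ-zero (λ u v → trans (cong (_* rigEntry p₁ u v w k) (c₁≡0 u v)) (*-zeroˡ (rigEntry p₁ u v w k)))) ⟨
      load p₁ c₁ w k + load p₂ c₂ w k    ≡⟨ split w k ⟩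
      0ℚ                                 ∎)

    c≡0 : ∀ u v → c u v ≡ 0ℚ
    c≡0 u v = begin
      c u v              ≡⟨ solve 2 (λ a b → a := b :+ (con 1ℚ :* a :+ con (- 1ℚ) :* b)) refl (c u v) (c₁ u v) ⟩
      c₁ u v + c₂ u v    ≡⟨ cong₂ _+_ (c₁≡0 u v) (c₂≡0 u v) ⟩
      0ℚ + 0ℚ            ∎

-- Deleting an edge e of E₁ leaves (E₁ - e) + f independent by minimality of the
-- first circuit and E₂ independent by minimality of the second.
independent-deletion : ∀ {n} {V₁ V₂ : VSet n} {E₁ E₂ : EdgeSet n} {x y} →
  IsGraph V₁ E₁ → IsGraph V₂ E₂ → Nonedge V₁ E₁ x y → Nonedge V₂ E₂ x y → InterIs V₁ V₂ x y →
  Circuit (addEdge E₁ x y) → Circuit (addEdge E₂ x y) → ∀ {F} →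
  (∀ u v → isPair F u v ≡ true → isPair E₁ u v ≡ true ⊎ isPair E₂ u v ≡ true) →
  ∀ {u v} → isPair E₁ u v ≡ true → isPair F u v ≡ false → Independent F
independent-deletion {n} {V₁} {V₂} {E₁} {E₂} {x} {y} G₁ G₂ (x≢y , _ , _ , xy∉E₁) (_ , _ , _ , xy∉E₂) inter
  (_ , minimal₁) (_ , minimal₂) {F} F⊆ {u} {v} uv∈E₁ uv∉F = independent (orient x≢y)
  where
  F₁ : EdgeSet n
  F₁ a b = E₁ a b ∧ F a b
  F₁⊆E₁ : F₁ ⊆E E₁
  F₁⊆E₁ a b ab = isPair⁺ E₁ (proj₁ (∧-true⁻ (proj₁ (isPair⁻ F₁ ab)))) (proj₂ (isPair⁻ F₁ ab))
  F₁⊆F : F₁ ⊆E F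
  F₁⊆F a b ab = isPair⁺ F (proj₂ (∧-true⁻ {E₁ a b} (proj₁ (isPair⁻ F₁ ab)))) (proj₂ (isPair⁻ F₁ ab))
  cover : ∀ a b → isPair F a b ≡ true → isPair F₁ a b ≡ true ⊎ isPair E₂ a b ≡ true
  cover a b ab with F⊆ a b ab
  ... | inj₁ ab₁ = inj₁ (isPair⁺ F₁ (∧-true⁺ (proj₁ (isPair⁻ E₁ ab₁)) (proj₁ (isPair⁻ F ab))) (proj₂ (isPair⁻ F ab)))
  ... | inj₂ ab₂ = inj₂ ab₂
  independent : (Σ (Fin n) λ s → Σ (Fin n) λ t → Oriented x y s t) → Independent F
  independent (s , t , o) = glued , free⇒rows {p = glued} {F} c≡0
    where
    st∉E₁ = nonedge-joins {E = E₁} G₁ xy∉E₁ (joins o)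
    st∉E₂ = nonedge-joins {E = E₂} G₂ xy∉E₂ (joins o)
    -- The deleted edge is not `f`, so adding `f` does not restore it and a proper subset of the
    -- circuit results.
    uv≢st : (u , v) ≢ (s , t)
    uv≢st refl = uv∈E₁ true-false st∉E₁
    i₁ : Independent (addEdge F₁ x y)
    i₁ = minimal₁ (addEdge F₁ x y) (addEdge-mono {E = F₁} {E₁} x y F₁⊆E₁)
      (u , v , ⊆-addEdge E₁ x y u v uv∈E₁ ,
       pair-addEdge-false {E = F₁} o (false-if (λ ab → F₁⊆F u v ab true-false uv∉F)) uv≢st)
    i₂ : Independent E₂
    i₂ = minimal₂ E₂ (⊆-addEdge E₂ x y) (s , t , new-pair {E = E₂} o , st∉E₂)
    pinned₁ = pin {p = proj₁ i₁} {addEdge F₁ x y} (rows⇒free {p = proj₁ i₁} {addEdge F₁ x y} (proj₂ i₁)) x≢y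
    pinned₂ = pin {p = proj₁ i₂} {E₂} (rows⇒free {p = proj₁ i₂} {E₂} (proj₂ i₂)) x≢y
    open Glue {V₁ = V₁} {V₂} {F} {F₁} {E₂} x≢y o inter
      (λ a b ab → endpoints {E = E₁} G₁ (F₁⊆E₁ a b ab)) (λ a b → endpoints {E = E₂} G₂) cover
      (false-if (λ ab → F₁⊆E₁ s t ab true-false st∉E₁))
      {proj₁ pinned₁} {proj₁ pinned₂} (proj₁ (proj₂ pinned₁)) (proj₁ (proj₂ pinned₂))
      (proj₁ (proj₂ (proj₂ pinned₁))) (proj₂ (proj₂ (proj₂ pinned₁)))
      (proj₁ (proj₂ (proj₂ pinned₂))) (proj₂ (proj₂ (proj₂ pinned₂)))

-- Rotating about a hinge

1F 2F : Fin 3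
1F = suc zero
2F = suc (suc zero)

-- `general` says that `a` and `b` are not coplanar with the axis: up to a constant factor the
-- determinant is the volume of the tetrahedron on `a`, `b`, `x`, `y`.
module Hinge {n : ℕ} {V₁ V₂ : VSet n} {H : EdgeSet n} {x y a b s t : Fin n}
  (inter : InterIs V₁ V₂ x y)
  (sides : ∀ u v → isPair H u v ≡ true → (V₁ u ≡ true × V₁ v ≡ true) ⊎ (V₂ u ≡ true × V₂ v ≡ true))
  (a∈V₁ : V₁ a ≡ true) (b∉V₁ : V₁ b ≡ false) (o : Oriented a b s t)
  {p : Realization n} (free : Free p H) (px : ∀ k → p x k ≡ 0ℚ) (py : ∀ k → p y k ≡ e₀ k)
  (general : p a 1F * p b 2F - p a 2F * p b 1F ≢ 0ℚ) where

  open ≡-Reasoning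

  -- Infinitesimal rotation of the second side about the axis xy; the first side rests.
  m₁ m₂ : Fin n → ℚ
  m₁ w = if V₁ w then 0ℚ else - p w 2F
  m₂ w = if V₁ w then 0ℚ else p w 1F

  -- Half the rate of change of the squared length; the axial coordinate is absent because the
  -- rotation has no velocity along its axis.
  extension : Fin n → Fin n → ℚ
  extension u v = (p u 1F - p v 1F) * (m₁ u - m₁ v) + (p u 2F - p v 2F) * (m₂ u - m₂ v)

  rests : ∀ {w} → V₁ w ≡ true → m₁ w ≡ 0ℚ × m₂ w ≡ 0ℚ
  rests {w} w∈V₁ rewrite w∈V₁ = refl , refl

  on-axis : ∀ w → V₁ w ≡ true → V₂ w ≡ true → ∀ k → p w (suc k) ≡ 0ℚ
  on-axis w w∈V₁ w∈V₂ k with proj₁ (inter w) (∧-true⁺ w∈V₁ w∈V₂)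
  ... | inj₁ refl = px (suc k)
  ... | inj₂ refl = py (suc k)

  -- A vertex of both sides lies on the axis, where rotating and resting are the same.
  rotates : ∀ {w} → V₂ w ≡ true → m₁ w ≡ - p w 2F × m₂ w ≡ p w 1F
  rotates {w} w∈V₂ with V₁ w in w∈V₁
  ... | false = refl , refl
  ... | true  = sym (cong (-_) (on-axis w w∈V₁ w∈V₂ (suc zero))) , sym (on-axis w w∈V₁ w∈V₂ zero)

  H-inextensible : ∀ u v → isPair H u v ≡ true → extension u v ≡ 0ℚ
  H-inextensible u v uv with sides u v uv
  ... | inj₁ (u∈ , v∈)
    rewrite proj₁ (rests u∈) | proj₂ (rests u∈) | proj₁ (rests v∈) | proj₂ (rests v∈) =
    solve 2 (λ d e → d :* (con 0ℚ :- con 0ℚ) :+ e :* (con 0ℚ :- con 0ℚ) := con 0ℚ) refl (p u 1F - p v 1F) (p u 2F - p v 2F)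
  ... | inj₂ (u∈ , v∈)
    rewrite proj₁ (rotates u∈) | proj₂ (rotates u∈) | proj₁ (rotates v∈) | proj₂ (rotates v∈) =
    solve 4 (λ u1 u2 v1 v2 → (u1 :- v1) :* (:- u2 :- :- v2) :+ (u2 :- v2) :* (u1 :- v1) := con 0ℚ) refl
      (p u 1F) (p u 2F) (p v 1F) (p v 2F)

  extension-ab : extension a b ≡ p a 1F * p b 2F - p a 2F * p b 1F
  extension-ab rewrite a∈V₁ | b∉V₁ =
    solve 4 (λ a1 a2 b1 b2 → (a1 :- b1) :* (con 0ℚ :- :- b2) :+ (a2 :- b2) :* (con 0ℚ :- b1) := a1 :* b2 :- a2 :* b1) refl
      (p a 1F) (p a 2F) (p b 1F) (p b 2F)

  extension-sym : ∀ u v → extension u v ≡ extension v u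
  extension-sym u v = solve 8 (λ a b c d e f g h → (a :- b) :* (c :- d) :+ (e :- f) :* (g :- h) := (b :- a) :* (d :- c) :+ (f :- e) :* (h :- g)) refl
    (p u 1F) (p v 1F) (m₁ u) (m₁ v) (p u 2F) (p v 2F) (m₂ u) (m₂ v)

  extension-st : extension s t ≢ 0ℚ
  extension-st with joins o
  ... | inj₁ (refl , refl) = λ ≡0 → general (trans (sym extension-ab) ≡0)
  ... | inj₂ (refl , refl) = λ ≡0 → general (trans (sym extension-ab) (trans (extension-sym a b) ≡0))

  -- A stress without load does no work against the rotation. Since `ab` alone changes length, its
  -- coefficient must vanish, and the rest is a stress of `H`.
  free-ab : Free p (addEdge H a b)
  free-ab c on eq = free c on-H eq
    where
    terms : ∀ u v → (u , v) ≢ (s , t) → c u v * extension u v ≡ 0ℚ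
    terms u v ≢st with isPair H u v in uv
    ... | true  = trans (cong (c u v *_) (H-inextensible u v uv)) (*-zeroʳ (c u v))
    ... | false = trans (cong (_* extension u v) (on u v (pair-addEdge-false {E = H} o uv ≢st))) (*-zeroˡ (extension u v))
    no-work : ∀ k m → ΣΣ (λ u v → c u v * ((p u k - p v k) * (m u - m v))) ≡ 0ℚ
    no-work k m = trans (sym (work p c k m)) (Σ-zero (λ w → trans (cong (_* m w) (eq w k)) (*-zeroˡ (m w))))
    power : extension s t * c s t ≡ 0ℚ
    power = begin
      extension s t * c s t
        ≡⟨ *-comm (extension s t) (c s t) ⟩
      c s t * extension s t
        ≡⟨ ΣΣ-single (λ u v → c u v * extension u v) s t terms ⟨
      ΣΣ (λ u v → c u v * extension u v)
        ≡⟨ ΣΣ-cong (λ u v → solve 3 (λ c d e → c :* (d :+ e) := con 1ℚ :* (c :* d) :+ con 1ℚ :* (c :* e)) refl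
             (c u v) ((p u 1F - p v 1F) * (m₁ u - m₁ v)) ((p u 2F - p v 2F) * (m₂ u - m₂ v))) ⟩
      ΣΣ (λ u v → 1ℚ * (c u v * ((p u 1F - p v 1F) * (m₁ u - m₁ v))) + 1ℚ * (c u v * ((p u 2F - p v 2F) * (m₂ u - m₂ v))))
        ≡⟨ ΣΣ-linear 1ℚ 1ℚ (λ u v → c u v * ((p u 1F - p v 1F) * (m₁ u - m₁ v))) (λ u v → c u v * ((p u 2F - p v 2F) * (m₂ u - m₂ v))) ⟩
      1ℚ * ΣΣ (λ u v → c u v * ((p u 1F - p v 1F) * (m₁ u - m₁ v))) + 1ℚ * ΣΣ (λ u v → c u v * ((p u 2F - p v 2F) * (m₂ u - m₂ v)))
        ≡⟨ cong₂ (λ q r → 1ℚ * q + 1ℚ * r) (no-work 1F m₁) (no-work 2F m₂) ⟩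
      1ℚ * 0ℚ + 1ℚ * 0ℚ ∎
    on-H : On H c
    on-H u v uv with (u , v) ≟² (s , t)
    ... | yes refl = no-zero-divisors {extension s t} power extension-st
    ... | no  ≢st  = on u v (pair-addEdge-false {E = H} o uv ≢st)

-- The determinant is linear in `a₂` with slope the negative of `b₁`; the excluded value is its only
-- root.
nondegenerate : ∀ {a₁ a₂ b₁ b₂ : ℚ} (b₁≢0 : b₁ ≢ 0ℚ) → a₂ ≢ proj₁ (inverse b₁≢0) * (a₁ * b₂) →
  a₁ * b₂ - a₂ * b₁ ≢ 0ℚ
nondegenerate {a₁} {a₂} {b₁} {b₂} b₁≢0 a₂≢ ≡0 = a₂≢ (begin
  a₂                                     ≡⟨ *-identityˡ a₂ ⟨
  1ℚ * a₂                                ≡⟨ cong (_* a₂) (proj₂ (inverse b₁≢0)) ⟨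
  i * b₁ * a₂                            ≡⟨ solve 4 (λ i b a s → i :* b :* a := i :* (s :- (s :- a :* b))) refl i b₁ a₂ (a₁ * b₂) ⟩
  i * (a₁ * b₂ - (a₁ * b₂ - a₂ * b₁))    ≡⟨ cong (λ z → i * (a₁ * b₂ - z)) ≡0 ⟩
  i * (a₁ * b₂ - 0ℚ)                     ≡⟨ cong (i *_) (+-identityʳ (a₁ * b₂)) ⟩
  i * (a₁ * b₂)                          ∎)
  where
  open ≡-Reasoning
  i = proj₁ (inverse b₁≢0)

-- Moving b off the plane in which its second coordinate vanishes and then a off
-- the plane through b and the axis xy makes the tetrahedron a b x y nondegenerate.
general-position : ∀ {n} {E : EdgeSet n} → Independent E → ∀ {x y a b} → x ≢ y →
  a ≢ x → a ≢ y → b ≢ x → b ≢ y → a ≢ b → Σ (Realization n) λ p →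
  Pinned E x y p × p a 1F * p b 2F - p a 2F * p b 1F ≢ 0ℚ
general-position {n} {E} (p₀ , rows) {x} {y} {a} {b} x≢y a≢x a≢y b≢x b≢y a≢b =
  move-b (pin {p = p₀} {E} (rows⇒free {p = p₀} {E} rows) x≢y)
  where
  Goal = Σ (Realization n) λ p → Pinned E x y p × p a 1F * p b 2F - p a 2F * p b 1F ≢ 0ℚ
  stay : ∀ {p w k β} → x ≢ w → y ≢ w → Pinned E x y p → (moved : Moved p E w k β) → Pinned E x y (proj₁ moved)
  stay x≢w y≢w (_ , px , py) (q , free , _ , fixed) =
    free , (λ k → trans (fixed x k (inj₁ x≢w)) (px k)) , (λ k → trans (fixed y k (inj₁ y≢w)) (py k))
  -- Moving the last coordinate of `a` changes none of the entries from which the excluded value was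
  -- computed.
  done : ∀ {p} → Pinned E x y p → (b₁≢0 : p b 1F ≢ 0ℚ) →
    Moved p E a 2F (proj₁ (inverse b₁≢0) * (p a 1F * p b 2F)) → Goal
  done {p} pinned b₁≢0 moved@(q , _ , a₂≢ , fixed) = q , stay {p} (a≢x ∘ sym) (a≢y ∘ sym) pinned moved ,
    λ ≡0 → nondegenerate {p a 1F} {q a 2F} {p b 1F} {p b 2F} b₁≢0 a₂≢ (trans (cong₂ _-_
      (sym (cong₂ _*_ (fixed a 1F (inj₂ λ ())) (fixed b 2F (inj₁ (a≢b ∘ sym)))))
      (cong (q a 2F *_) (sym (fixed b 1F (inj₁ (a≢b ∘ sym)))))) ≡0)
  move-a : ∀ {p} → Pinned E x y p → Moved p E b 1F 0ℚ → Goal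
  move-a {p} pinned moved@(q , free , b₁≢0 , _) = done {q} (stay {p} (b≢x ∘ sym) (b≢y ∘ sym) pinned moved) b₁≢0
    (moveOff {p = q} {E} free a 2F (proj₁ (inverse b₁≢0) * (q a 1F * q b 2F)))
  move-b : Σ (Realization n) (Pinned E x y) → Goal
  move-b (p , pinned) = move-a {p} pinned (moveOff {p = p} {E} (proj₁ pinned) b 1F 0ℚ)

-- Edge counts and nucleations

Σℕ-mono : ∀ {m} {f g : Fin m → ℕ} → (∀ i → f i ≤ℕ g i) → Σℕ f ≤ℕ Σℕ g
Σℕ-mono {zero}  f≤g = ℕ.≤-refl
Σℕ-mono {suc m} f≤g = ℕ.+-mono-≤ (f≤g zero) (Σℕ-mono (f≤g ∘ suc))

Σℕ-strict : ∀ {m} {f g : Fin m → ℕ} → (∀ i → f i ≤ℕ g i) → ∀ j → f j < g j → Σℕ f < Σℕ g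
Σℕ-strict f≤g zero    f<g = ℕ.+-mono-<-≤ f<g (Σℕ-mono (f≤g ∘ suc))
Σℕ-strict f≤g (suc j) f<g = ℕ.+-mono-≤-< (f≤g zero) (Σℕ-strict (f≤g ∘ suc) j f<g)

countE-strict : ∀ {n} {E F : EdgeSet n} → E ⊆E F → ∀ {s t} →
  isPair E s t ≡ false → isPair F s t ≡ true → countE E < countE F
countE-strict {E = E} {F} E⊆F {s} {t} st∉E st∈F =
  Σℕ-strict (λ u → Σℕ-mono (indicator≤ u)) s (Σℕ-strict (indicator≤ s) t new)
  where
  indicator≤ : ∀ u v → (if isPair E u v then 1 else 0) ≤ℕ (if isPair F u v then 1 else 0)
  indicator≤ u v with isPair E u v in uv
  ... | false = z≤n
  ... | true rewrite E⊆F u v uv = ℕ.≤-refl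
  new : (if isPair E s t then 1 else 0) < (if isPair F s t then 1 else 0)
  new rewrite st∉E | st∈F = ℕ.≤-refl

-- A maximal independent H ⊆ F leaves the hinge free, so H + ab is independent:
-- the rank of F is not that of the complete graph.
not-rigid : ∀ {n} {V₁ V₂ W : VSet n} {F : EdgeSet n} {x y a b} → x ≢ y → InterIs V₁ V₂ x y →
  (∀ u v → isPair F u v ≡ true → (V₁ u ≡ true × V₁ v ≡ true) ⊎ (V₂ u ≡ true × V₂ v ≡ true)) →
  Ends W F → W a ≡ true → W b ≡ true → V₁ a ≡ true → V₂ a ≡ false → V₁ b ≡ false → V₂ b ≡ true → ¬ Rigid W F
not-rigid {n} {V₁} {V₂} {W} {F} {x} {y} {a} {b} x≢y inter sides ends a∈W b∈W a∈V₁ a∉V₂ b∉V₁ b∈V₂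
  (r , ((H , H⊆F , indep , countH) , _) , (_ , bound)) = contradict (orient a≢b)
    (general-position {E = H} indep x≢y (a∉xy ∘ inj₁) (a∉xy ∘ inj₂) (b∉xy ∘ inj₁) (b∉xy ∘ inj₂) a≢b)
  where
  a≢b : a ≢ b
  a≢b refl = a∈V₁ true-false b∉V₁
  common : ∀ {w} → w ≡ x ⊎ w ≡ y → V₁ w ≡ true × V₂ w ≡ true
  common {w} w∈ = proj₁ (∧-true⁻ (proj₂ (inter w) w∈)) , proj₂ (∧-true⁻ {V₁ w} (proj₂ (inter w) w∈))
  a∉xy : ¬ (a ≡ x ⊎ a ≡ y)
  a∉xy a∈ = proj₂ (common a∈) true-false a∉V₂
  b∉xy : ¬ (b ≡ x ⊎ b ≡ y)
  b∉xy b∈ = proj₁ (common b∈) true-false b∉V₁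
  contradict : (Σ (Fin n) λ s → Σ (Fin n) λ t → Oriented a b s t) →
    (Σ (Realization n) λ p → Pinned H x y p × p a 1F * p b 2F - p a 2F * p b 1F ≢ 0ℚ) → ⊥
  -- `H` has `r` edges, so `G` has more than `r`, against the rank bound for the complete graph on
  -- `W`.
  contradict (s , t , o) (p , (free , px , py) , general) = <-irrefl refl (ℕ.<-≤-trans
      (subst (_< countE G) countH (countE-strict {E = H} {G} (⊆-addEdge H a b) st∉H (new-pair {E = H} o)))
      (bound G G⊆K (p , free⇒rows {p = p} {G} free-ab)))
    where
    open Hinge {V₁ = V₁} {V₂} {H} inter (λ u v uv → sides u v (H⊆F u v uv)) a∈V₁ b∉V₁ o {p} free px py general
    G : EdgeSet n
    G = addEdge H a b
    st∉H : isPair H s t ≡ false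
    st∉H = false-if (λ st → apart (joins o) (sides s t (H⊆F s t st)))
      where
      apart : Joins a b s t → (V₁ s ≡ true × V₁ t ≡ true) ⊎ (V₂ s ≡ true × V₂ t ≡ true) → ⊥
      apart (inj₁ (refl , refl)) (inj₁ (_ , b∈V₁)) = b∈V₁ true-false b∉V₁
      apart (inj₁ (refl , refl)) (inj₂ (a∈V₂ , _)) = a∈V₂ true-false a∉V₂
      apart (inj₂ (refl , refl)) (inj₁ (b∈V₁ , _)) = b∈V₁ true-false b∉V₁
      apart (inj₂ (refl , refl)) (inj₂ (_ , a∈V₂)) = a∈V₂ true-false a∉V₂
    in-W : ∀ {u v} → isPair G u v ≡ true → W u ≡ true × W v ≡ true
    in-W {u} {v} uv with pair-addEdge {E = H} o uv
    ... | inj₁ uv∈H = ends u v (H⊆F u v uv∈H)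
    ... | inj₂ refl with joins o
    ...   | inj₁ (refl , refl) = a∈W , b∈W
    ...   | inj₂ (refl , refl) = b∈W , a∈W
    G⊆K : G ⊆E K W
    G⊆K u v uv = isPair⁺ (K W) (∧-true⁺ (proj₁ (in-W uv)) (∧-true⁺ (proj₂ (in-W uv)) u≢v)) u<v
      where
      u<v = proj₂ (isPair⁻ G uv)
      u≢v : not ⌊ u ≟ v ⌋ ≡ true
      u≢v with u ≟ v
      ... | yes refl = contradiction u<v (<-irrefl refl)
      ... | no  _    = refl

-- The only pair inside both vertex sets is f.
one-sided : ∀ {n} {V₁ V₂ W : VSet n} {E₁ E₂ F : EdgeSet n} {x y} →
  IsGraph V₂ E₂ → E₂ x y ≡ false → InterIs V₁ V₂ x y →
  F ⊆E (E₁ ∪E E₂) → Ends W F → (∀ w → W w ≡ true → V₁ w ≡ true) → F ⊆E E₁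
one-sided {V₁ = V₁} {V₂} {W} {E₁} {E₂} {F} {x} {y} G₂ xy∉E₂ inter F⊆ ends W⊆V₁ u v uv with pair-∪ E₁ E₂ (F⊆ u v uv)
... | inj₁ uv₁ = uv₁
... | inj₂ uv₂ with hinge (proj₁ (ends u v uv)) (proj₁ (endpoints {E = E₂} G₂ uv₂))
                  | hinge (proj₂ (ends u v uv)) (proj₂ (endpoints {E = E₂} G₂ uv₂))
  where
  hinge : ∀ {w} → W w ≡ true → V₂ w ≡ true → w ≡ x ⊎ w ≡ y
  hinge {w} w∈W w∈V₂ = proj₁ (inter w) (∧-true⁺ (W⊆V₁ w w∈W) w∈V₂)
...   | inj₁ refl | inj₁ refl = contradiction (proj₂ (isPair⁻ F uv)) (<-irrefl refl)
...   | inj₁ u≡x  | inj₂ v≡y  = uv₂ true-false nonedge-joins {E = E₂} G₂ xy∉E₂ (inj₁ (u≡x , v≡y))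
...   | inj₂ u≡y  | inj₁ v≡x  = uv₂ true-false nonedge-joins {E = E₂} G₂ xy∉E₂ (inj₂ (u≡y , v≡x))
...   | inj₂ refl | inj₂ refl = contradiction (proj₂ (isPair⁻ F uv)) (<-irrefl refl)

inter-sym : ∀ {n} {V₁ V₂ : VSet n} {x y} → InterIs V₁ V₂ x y → InterIs V₂ V₁ x y
inter-sym {V₁ = V₁} {V₂} inter v =
  (λ eq → proj₁ (inter v) (trans (∧-comm (V₁ v) (V₂ v)) eq)) , λ v∈ → trans (∧-comm (V₂ v) (V₁ v)) (proj₂ (inter v) v∈)

∪-comm-⊆ : ∀ {n} (E₁ E₂ : EdgeSet n) → (E₁ ∪E E₂) ⊆E (E₂ ∪E E₁)
∪-comm-⊆ E₁ E₂ u v uv = [ ⊆-∪ʳ E₂ E₁ u v , ⊆-∪ˡ E₂ E₁ u v ]′ (pair-∪ E₁ E₂ uv)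

member-outside? : ∀ {n} (W V : VSet n) →
  (Σ (Fin n) λ w → W w ≡ true × V w ≡ false) ⊎ (∀ w → W w ≡ true → V w ≡ true)
member-outside? W V with any? (λ w → (W w ≟ᵇ true) ×-dec (V w ≟ᵇ false))
... | yes found = inj₁ found
... | no  none  = inj₂ inside
  where
  inside : ∀ w → W w ≡ true → V w ≡ true
  inside w w∈W with V w in w∈V
  ... | true  = refl
  ... | false = contradiction (w , w∈W , w∈V) none

nucleationFree-∪ : ∀ {n} {V₁ V₂ : VSet n} {E₁ E₂ : EdgeSet n} {x y} →
  IsGraph V₁ E₁ → IsGraph V₂ E₂ → Nonedge V₁ E₁ x y → Nonedge V₂ E₂ x y → InterIs V₁ V₂ x y →
  NucleationFree V₁ E₁ → NucleationFree V₂ E₂ → NucleationFree (V₁ ∪V V₂) (E₁ ∪E E₂)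
nucleationFree-∪ {V₁ = V₁} {V₂} {E₁} {E₂} G₁ G₂ (x≢y , _ , _ , xy∉E₁) (_ , _ , _ , xy∉E₂) inter nf₁ nf₂
  (W , F , W⊆V , F⊆E , ends , big , rigid)
  with member-outside? W V₂ | member-outside? W V₁
... | inj₂ W⊆V₂ | _ = nf₂ (W , F , W⊆V₂ , F⊆E₂ , ends , big , rigid)
  where
  F⊆E₂ = one-sided {V₁ = V₂} {V₁} {W} {E₂} {E₁} {F} G₁ xy∉E₁ (inter-sym {V₁ = V₁} {V₂} inter)
    (λ u v uv → ∪-comm-⊆ E₁ E₂ u v (F⊆E u v uv)) ends W⊆V₂
... | inj₁ _ | inj₂ W⊆V₁ = nf₁ (W , F , W⊆V₁ , F⊆E₁ , ends , big , rigid)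
  where
  F⊆E₁ = one-sided {V₁ = V₁} {V₂} {W} {E₁} {E₂} {F} G₂ xy∉E₂ inter F⊆E ends W⊆V₁
... | inj₁ (a , a∈W , a∉V₂) | inj₁ (b , b∈W , b∉V₁) =
  not-rigid {V₁ = V₁} {V₂} {W} {F} x≢y inter sides ends a∈W b∈W a∈V₁ a∉V₂ b∉V₁ b∈V₂ rigid
  where
  a∈V₁ : V₁ a ≡ true
  a∈V₁ = [ id , _true-false a∉V₂ ]′ (∨-true⁻ (W⊆V a a∈W))
  b∈V₂ : V₂ b ≡ true
  b∈V₂ = [ _true-false b∉V₁ , id ]′ (∨-true⁻ (W⊆V b b∈W))
  sides : ∀ u v → isPair F u v ≡ true → (V₁ u ≡ true × V₁ v ≡ true) ⊎ (V₂ u ≡ true × V₂ v ≡ true)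
  sides u v uv = [ inj₁ ∘ endpoints {E = E₁} G₁ , inj₂ ∘ endpoints {E = E₂} G₂ ]′ (pair-∪ E₁ E₂ (F⊆E u v uv))

-- The three statements about the union

nonedge-∪ : ∀ {n} {V₁ V₂ : VSet n} {E₁ E₂ : EdgeSet n} {x y} →
  Nonedge V₁ E₁ x y → Nonedge V₂ E₂ x y → Nonedge (V₁ ∪V V₂) (E₁ ∪E E₂) x y
nonedge-∪ (x≢y , x∈ , y∈ , xy∉E₁) (_ , _ , _ , xy∉E₂) = x≢y , ∨-true⁺ˡ x∈ , ∨-true⁺ˡ y∈ , cong₂ _∨_ xy∉E₁ xy∉E₂

theorem8 : ∀ {n : ℕ} (V₁ V₂ : VSet n) (E₁ E₂ : EdgeSet n) (x y : Fin n) →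
    IsGraph V₁ E₁ → IsGraph V₂ E₂ → EdgeDisjoint E₁ E₂ →
    Nonedge V₁ E₁ x y → Nonedge V₂ E₂ x y →
    ((NucleationFree V₁ E₁ × NucleationFree V₂ E₂ × InterIs V₁ V₂ x y) →
    NucleationFree (V₁ ∪V V₂) (E₁ ∪E E₂))
    × ((Implied V₁ E₁ x y × Implied V₂ E₂ x y) →
    Dependent (E₁ ∪E E₂) × Implied (V₁ ∪V V₂) (E₁ ∪E E₂) x y)
    × ((InterIs V₁ V₂ x y × Circuit (addEdge E₁ x y) × Circuit (addEdge E₂ x y)) →
    Circuit (E₁ ∪E E₂) × Implied (V₁ ∪V V₂) (E₁ ∪E E₂) x y)
theorem8 {n} V₁ V₂ E₁ E₂ x y G₁ G₂ disjoint ne₁@(x≢y , _ , _ , _) ne₂ = nucleationFree , implied , circuit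
  where
  nucleationFree : NucleationFree V₁ E₁ × NucleationFree V₂ E₂ × InterIs V₁ V₂ x y →
    NucleationFree (V₁ ∪V V₂) (E₁ ∪E E₂)
  nucleationFree (nf₁ , nf₂ , inter) =
    nucleationFree-∪ {V₁ = V₁} {V₂} {E₁} {E₂} G₁ G₂ ne₁ ne₂ inter nf₁ nf₂

  -- Being a circuit does not refer to an ambient graph, so a circuit through `f` on the first side
  -- also witnesses the union.
  implied-∪ : ∀ {C} → C ⊆E addEdge E₁ x y → Circuit C → hasPair C x y → Implied (V₁ ∪V V₂) (E₁ ∪E E₂) x y
  implied-∪ {C} C⊆ circ f∈C = nonedge-∪ {V₁ = V₁} {V₂} {E₁} {E₂} ne₁ ne₂ , C ,
    (λ u v uv → addEdge-mono {E = E₁} {E₁ ∪E E₂} x y (⊆-∪ˡ E₁ E₂) u v (C⊆ u v uv)) , circ , f∈C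

  implied : Implied V₁ E₁ x y × Implied V₂ E₂ x y →
    Dependent (E₁ ∪E E₂) × Implied (V₁ ∪V V₂) (E₁ ∪E E₂) x y
  implied ((_ , C₁ , C₁⊆ , circ₁ , f∈C₁) , (_ , C₂ , C₂⊆ , circ₂ , _)) =
    dependent-∪ {E₁ = E₁} {E₂} {C₁} {C₂} x≢y disjoint C₁⊆ C₂⊆ (proj₁ circ₁) (proj₁ circ₂) ,
    implied-∪ C₁⊆ circ₁ f∈C₁

  circuit : InterIs V₁ V₂ x y × Circuit (addEdge E₁ x y) × Circuit (addEdge E₂ x y) →
    Circuit (E₁ ∪E E₂) × Implied (V₁ ∪V V₂) (E₁ ∪E E₂) x y
  circuit (inter , circ₁ , circ₂) =
    (dependent-∪ {E₁ = E₁} {E₂} {addEdge E₁ x y} {addEdge E₂ x y} x≢y disjoint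
       (λ _ _ → id) (λ _ _ → id) (proj₁ circ₁) (proj₁ circ₂) , minimal) ,
    implied-∪ (λ _ _ → id) circ₁ (hasPair-addEdge E₁ x≢y)
    where
    minimal : ∀ F → F ⊆E (E₁ ∪E E₂) →
      (Σ (Fin n) λ u → Σ (Fin n) λ v → isPair (E₁ ∪E E₂) u v ≡ true × isPair F u v ≡ false) → Independent F
    minimal F F⊆ (u , v , uv , uv∉F) with pair-∪ E₁ E₂ uv
    ... | inj₁ uv₁ = independent-deletion {V₁ = V₁} {V₂} {E₁} {E₂} G₁ G₂ ne₁ ne₂ inter circ₁ circ₂
                       (λ a b ab → pair-∪ E₁ E₂ (F⊆ a b ab)) uv₁ uv∉F
    -- The side that loses an edge is the one that keeps `f`, so the two sides exchange roles.
    ... | inj₂ uv₂ = independent-deletion {V₁ = V₂} {V₁} {E₂} {E₁} G₂ G₁ ne₂ ne₁ (inter-sym {V₁ = V₁} {V₂} inter) circ₂ circ₁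
                       (λ a b ab → pair-∪ E₂ E₁ (∪-comm-⊆ E₁ E₂ a b (F⊆ a b ab))) uv₂ uv∉F
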